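{- Let $r$ and $\ell$ be two positive integers with $\ell\le r-1$, and let $n$ be a positive integer. Let $h_{n,0}(x),h_{n,1}(x),\dots,h_{n,r-1}(x)$ be the polynomials such that $$\left(1+x+x^2+\cdots+x^{\ell}\right)^n=h_{n,0}(x^r)+x h_{n,1}(x^r)+\cdots+x^{r-1}h_{n,r-1}(x^r).$$ Then the polynomial sequence $\left(h_{n,r-1}(x),\dots,h_{n,1}(x),h_{n,0}(x)\right)$ is interlacing.
   Context: The polynomials $h_{n,0},\dots,h_{n,r-1}$ are uniquely determined by the displayed identity. Interlacing of two polynomials: let $f(x)$ and $g(x)$ be real-rooted polynomials with positive leading coefficients, with zeros (listed with multiplicity in weakly decreasing order) $u_1\ge u_2\ge\cdots$ and $v_1\ge v_2\ge\cdots$, respectively. Then $g$ interlaces $f$, written $g\ll f$, if either $\deg f=\deg g=d$ and $v_d\le u_d\le v_{d-1}\le\cdots\le v_2\le u_2\le v_1\le u_1$, or $\deg f=\deg g+1=d$ and $u_d\le v_{d-1}\le\cdots\le v_2\le u_2\le v_1\le u_1$. By convention, $0\ll f$ and $f\ll 0$ for any real-rooted polynomial $f$, where the zero polynomial is regarded as real-rooted (so also $0\ll 0$). Interlacing sequence: a sequence $(f_1(x),\dots,f_m(x))$ of real-rooted polynomials, each of which is either zero or has positive leading coefficient, is interlacing if $f_i(x)\ll f_j(x)$ for all $1\le i<j\le m$. -}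

module Defs where

open import Algebra.Bundles using (CommutativeRing; RawSemiring)
import Algebra.Definitions.RawMonoid as RawMonoidDefs
import Algebra.Definitions.RawSemiring as RawSemiringDefs
open import Data.Fin as Fin using (Fin; toℕ)
open import Data.List using (List; []; _∷_; map)
open import Data.Nat as ℕ using (ℕ; zero; suc)
open import Data.Product using (∃; ∃-syntax; _×_)
open import Data.Sum using (_⊎_)
open import Data.Vec.Functional using (Vector)
open import Level using (0ℓ) renaming (suc to lsuc)
open import Relation.Binary using (Rel; IsStrictTotalOrder)
open import Relation.Binary.PropositionalEquality using (_≡_)
open import Relation.Nullary using (¬_)
open import Relation.Unary using (Pred)

-- The real numbers, given by their classical characterisation as the
-- Dedekind-complete ordered field (unique up to isomorphism).  Both the
-- decidable trichotomy in IsStrictTotalOrder and the supremum principle for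
-- arbitrary predicates are to be read classically.
record CompleteOrderedField : Set (lsuc 0ℓ) where
  field
    commutativeRing : CommutativeRing 0ℓ 0ℓ

  open CommutativeRing commutativeRing public

  infix 4 _<_ _≤_

  field
    _<_                : Rel Carrier 0ℓ
    isStrictTotalOrder : IsStrictTotalOrder _≈_ _<_
    0≉1                : ¬ 0# ≈ 1#
    inverse            : ∀ x → ¬ x ≈ 0# → ∃[ y ] x * y ≈ 1#
    +-monoˡ-<          : ∀ z {x y} → x < y → x + z < y + z
    *-pos              : ∀ {x y} → 0# < x → 0# < y → 0# < x * y

  _≤_ : Rel Carrier 0ℓ
  x ≤ y = x < y ⊎ x ≈ y

  UpperBound : Pred Carrier 0ℓ → Pred Carrier 0ℓ
  UpperBound S b = ∀ x → S x → x ≤ b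

  field
    supremum : (S : Pred Carrier 0ℓ) → ∃ S → ∃ (UpperBound S) →
               ∃[ s ] UpperBound S s × (∀ b → UpperBound S b → s ≤ b)

module Polynomials (ℝ : CompleteOrderedField) where

  open CompleteOrderedField ℝ

  -- Coefficients are listed from the constant term upwards; trailing zeros are
  -- allowed, and _≈ₚ_ identifies lists that differ only by them.
  Poly : Set
  Poly = List Carrier

  coeff : Poly → ℕ → Carrier
  coeff []      _       = 0#
  coeff (a ∷ p) zero    = a
  coeff (a ∷ p) (suc k) = coeff p k

  infix  4 _≈ₚ_
  infixl 6 _+ₚ_
  infixl 7 _*ₚ_

  _≈ₚ_ : Rel Poly 0ℓ
  p ≈ₚ q = ∀ k → coeff p k ≈ coeff q k

  0ₚ 1ₚ X : Poly
  0ₚ = []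
  1ₚ = 1# ∷ []
  X  = 0# ∷ 1# ∷ []

  C : Carrier → Poly
  C a = a ∷ []

  _+ₚ_ : Poly → Poly → Poly
  []      +ₚ q       = q
  (a ∷ p) +ₚ []      = a ∷ p
  (a ∷ p) +ₚ (b ∷ q) = (a + b) ∷ (p +ₚ q)

  _*ₚ_ : Poly → Poly → Poly
  []      *ₚ q = []
  (a ∷ p) *ₚ q = map (a *_) q +ₚ (0# ∷ (p *ₚ q))

  -- p ⟨ q ⟩ is the composite p(q(x)).
  infix 9 _⟨_⟩
  _⟨_⟩ : Poly → Poly → Poly
  []      ⟨ q ⟩ = 0ₚ
  (a ∷ p) ⟨ q ⟩ = C a +ₚ q *ₚ (p ⟨ q ⟩)

  polyRawSemiring : RawSemiring 0ℓ 0ℓ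
  polyRawSemiring = record
    { Carrier = Poly ; _≈_ = _≈ₚ_
    ; _+_ = _+ₚ_ ; _*_ = _*ₚ_ ; 0# = 0ₚ ; 1# = 1ₚ
    }

  open RawSemiringDefs polyRawSemiring public using () renaming (_^_ to _^ₚ_)
  open RawMonoidDefs (RawSemiring.+-rawMonoid polyRawSemiring) public
    using () renaming (sum to ∑)
  open RawMonoidDefs (RawSemiring.*-rawMonoid polyRawSemiring) public
    using () renaming (sum to ∏)

  PositiveLeading : Pred Poly 0ℓ
  PositiveLeading f =
    ∃[ d ] 0# < coeff f d × (∀ k → d ℕ.< k → coeff f k ≈ 0#)

  -- u lists all the zeros of the nonzero polynomial f, with multiplicity and
  -- in weakly decreasing order, and all of them are real; in particular d is
  -- the degree of f.
  record ZeroList (f : Poly) {d : ℕ} (u : Vector Carrier d) : Set where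
    field
      decreasing    : ∀ {i j} → i Fin.≤ j → u j ≤ u i
      constant      : Carrier
      constant≉0    : ¬ constant ≈ 0#
      factorisation : f ≈ₚ C constant *ₚ ∏ (λ i → X +ₚ C (- u i))

  RealRooted : Pred Poly 0ℓ
  RealRooted f =
    f ≈ₚ 0ₚ ⊎ (∃[ d ] ∃[ u ] ZeroList f {d} u)

  infix 4 _≪_
  data _≪_ (g f : Poly) : Set where
    zero-≪ : g ≈ₚ 0ₚ → RealRooted f → g ≪ f
    ≪-zero : f ≈ₚ 0ₚ → RealRooted g → g ≪ f

    sameDegree : ∀ {d} {u v : Vector Carrier d} →
      PositiveLeading f → ZeroList f u →
      PositiveLeading g → ZeroList g v →
      (∀ i → v i ≤ u i) →
      (∀ i j → toℕ j ≡ suc (toℕ i) → u j ≤ v i) →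
      g ≪ f

    nextDegree : ∀ {d} {u : Vector Carrier (suc d)} {v : Vector Carrier d} →
      PositiveLeading f → ZeroList f u →
      PositiveLeading g → ZeroList g v →
      (∀ i → v i ≤ u (Fin.inject₁ i)) →
      (∀ i → u (Fin.suc i) ≤ v i) →
      g ≪ f

  record Interlacing {m : ℕ} (f : Vector Poly m) : Set where
    field
      realRooted  : ∀ i → RealRooted (f i)
      leading     : ∀ i → f i ≈ₚ 0ₚ ⊎ PositiveLeading (f i)
      interlacing : ∀ {i j} → i Fin.< j → f i ≪ f j

module Submission where

-- Write f ≪ g when the zeros of g and f alternate, starting with the
-- largest zero of g. If all zeros are nonpositive then f ≪ g is equivalent to
-- g ≪ x f. The relation is closed under sums on the right, by a sign count at
-- the zeros of f, hence also on the left by the equivalence. Continue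
-- h_{n,r-1}, …, h_{n,0} to an infinite sequence F with F (k + r) = x F k. Then
-- multiplication by 1 + x + … + x^ℓ replaces F k by the sum of the ℓ + 1 ≤ r
-- terms starting at F k, and cutting these sums at their common parts shows that
-- the property "F i ≪ F j for i ≤ j ≤ i + r" is inherited.

-- The relation `⊑` used for sequences holds vacuously as soon as one side is the zero polynomial,
-- and sections of small powers do vanish. It is therefore not transitive, and comparing neighbours
-- would not suffice: the induction carries every pair at distance at most r. The pairs i = j matter
-- too, because `F i ⊑ F i` is the form in which real-rootedness is carried. Sums of real-rooted
-- polynomials are not real-rooted in general, so it has to be proved again for each window from the
-- comparisons among its terms. Distance r is the natural range, since rotation turns `F i ⊑ F j`
-- into `F j ⊑ F (i + r)`; a window that sticks out beyond i + r is compared with the other one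
-- moved up by r. The sign count has an obstacle of its own: interlacing admits shared and multiple
-- zeros, where signs are only weak and the intermediate value theorem says nothing. This is why
-- common zeros must be inserted into and removed from interlacing pairs.

open import Defs
import Algebra.Properties.AbelianGroup as AbelianGroupProperties
import Algebra.Properties.CommutativeSemigroup as CommutativeSemigroupProperties
import Algebra.Properties.Group as GroupProperties
import Algebra.Properties.Monoid.Mult as MonoidMult
import Algebra.Properties.Ring as RingProperties
import Algebra.Properties.Semiring.Mult as SemiringMult
import Algebra.Solver.Ring as RingSolver
open import Algebra.Bundles using (CommutativeRing)
open import Algebra.Solver.Ring.AlmostCommutativeRing
  using (fromCommutativeRing; _-Raw-AlmostCommutative⟶_)
open import Data.Empty using (⊥-elim)
open import Data.Fin as Fin using (Fin; toℕ; opposite)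
import Data.Fin.Properties as Fin
open import Data.Integer as ℤ using (ℤ; +_; -[1+_])
import Data.Integer.Properties as ℤ
open import Data.List using (List; []; _∷_; map; length)
open import Data.Maybe using (Maybe; just; nothing)
open import Data.Nat as ℕ using (ℕ; zero; suc; z≤n; s≤s; _∸_)
open import Data.Nat.Divisibility using (_∣_; _∣?_; divides)
import Data.Nat.Properties as ℕ
open import Data.Nat.Solver using (module +-*-Solver)
open import Data.Product using (∃; ∃-syntax; _×_; _,_; proj₁; proj₂)
open import Data.Sum using (_⊎_; inj₁; inj₂)
open import Data.Unit using (⊤; tt)
open import Data.Vec.Functional as Vector using (Vector)
open import Function using (_∘_)
open import Relation.Binary using (IsStrictTotalOrder; Tri; tri<; tri≈; tri>)
import Relation.Binary.Construct.StrictToNonStrict as ToNonStrict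
open import Relation.Binary.PropositionalEquality as ≡ using (_≡_)
import Relation.Binary.Reasoning.Setoid as SetoidReasoning
open import Relation.Nullary using (¬_; Dec; yes; no)

-- A ring solver with integer coefficients for commutative rings.

module IntegerSolver {c ℓ} (R : CommutativeRing c ℓ) where
  open CommutativeRing R
  open RingProperties ring using (-‿distribˡ-*; -‿distribʳ-*; -0#≈0#)
  open AbelianGroupProperties +-abelianGroup using (⁻¹-involutive; ⁻¹-∙-comm)
  open MonoidMult +-monoid using (×-homo-+) renaming (_×_ to _·_)
  open SemiringMult semiring using (×1-homo-*)
  open SetoidReasoning setoid

  fromℤ : ℤ → Carrier
  fromℤ (+ n)    = n · 1#
  fromℤ -[1+ n ] = - (suc n · 1#)

  fromℤ-neg : ∀ i → fromℤ (ℤ.- i) ≈ - fromℤ i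
  fromℤ-neg (+ zero)  = sym -0#≈0#
  fromℤ-neg (+ suc n) = refl
  fromℤ-neg -[1+ n ]  = sym (⁻¹-involutive _)

  private
    cancel-+ : ∀ x y z → (x + y) + - (x + z) ≈ y + - z
    cancel-+ x y z = begin
      (x + y) + - (x + z)      ≈⟨ +-congˡ (⁻¹-∙-comm x z) ⟨
      (x + y) + (- x + - z)    ≈⟨ +-congʳ (+-comm x y) ⟩
      (y + x) + (- x + - z)    ≈⟨ +-assoc y x _ ⟩
      y + (x + (- x + - z))    ≈⟨ +-congˡ (+-assoc x (- x) (- z)) ⟨
      y + ((x + - x) + - z)    ≈⟨ +-congˡ (+-congʳ (-‿inverseʳ x)) ⟩
      y + (0# + - z)           ≈⟨ +-congˡ (+-identityˡ _) ⟩
      y + - z                  ∎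

  fromℤ-⊖ : ∀ m n → fromℤ (m ℤ.⊖ n) ≈ m · 1# + - (n · 1#)
  fromℤ-⊖ zero    zero    = sym (trans (+-identityˡ _) -0#≈0#)
  fromℤ-⊖ zero    (suc n) = sym (+-identityˡ _)
  fromℤ-⊖ (suc m) zero    = sym (trans (+-congˡ -0#≈0#) (+-identityʳ _))
  fromℤ-⊖ (suc m) (suc n) = begin
    fromℤ (suc m ℤ.⊖ suc n)             ≡⟨ ≡.cong fromℤ (ℤ.[1+m]⊖[1+n]≡m⊖n m n) ⟩
    fromℤ (m ℤ.⊖ n)                     ≈⟨ fromℤ-⊖ m n ⟩
    m · 1# + - (n · 1#)                 ≈⟨ cancel-+ 1# _ _ ⟨
    (1# + m · 1#) + - (1# + n · 1#)     ∎

  fromℤ-+ : ∀ i j → fromℤ (i ℤ.+ j) ≈ fromℤ i + fromℤ j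
  fromℤ-+ (+ m)    (+ n)    = ×-homo-+ 1# m n
  fromℤ-+ (+ m)    -[1+ n ] = fromℤ-⊖ m (suc n)
  fromℤ-+ -[1+ m ] (+ n)    = trans (fromℤ-⊖ n (suc m)) (+-comm _ _)
  fromℤ-+ -[1+ m ] -[1+ n ] = begin
    - (suc (suc (m ℕ.+ n)) · 1#)      ≡⟨ ≡.cong (λ k → - (suc k · 1#)) (ℕ.+-suc m n) ⟨
    - ((suc m ℕ.+ suc n) · 1#)        ≈⟨ -‿cong (×-homo-+ 1# (suc m) (suc n)) ⟩
    - (suc m · 1# + suc n · 1#)       ≈⟨ ⁻¹-∙-comm _ _ ⟨
    - (suc m · 1#) + - (suc n · 1#)   ∎

  private
    *-pos-homo : ∀ m n → fromℤ (+ m ℤ.* + n) ≈ fromℤ (+ m) * fromℤ (+ n)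
    *-pos-homo m n = trans (reflexive (≡.cong fromℤ (≡.sym (ℤ.pos-* m n)))) (×1-homo-* m n)

    *-homo-negʳ : ∀ i j → fromℤ (i ℤ.* j) ≈ fromℤ i * fromℤ j →
                  fromℤ (i ℤ.* (ℤ.- j)) ≈ fromℤ i * fromℤ (ℤ.- j)
    *-homo-negʳ i j eq = begin
      fromℤ (i ℤ.* (ℤ.- j))     ≡⟨ ≡.cong fromℤ (ℤ.neg-distribʳ-* i j) ⟨
      fromℤ (ℤ.- (i ℤ.* j))     ≈⟨ fromℤ-neg (i ℤ.* j) ⟩
      - fromℤ (i ℤ.* j)         ≈⟨ -‿cong eq ⟩
      - (fromℤ i * fromℤ j)     ≈⟨ -‿distribʳ-* _ _ ⟩
      fromℤ i * - fromℤ j       ≈⟨ *-congˡ (fromℤ-neg j) ⟨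
      fromℤ i * fromℤ (ℤ.- j)   ∎

    *-homo-negˡ : ∀ i j → fromℤ (i ℤ.* j) ≈ fromℤ i * fromℤ j →
                  fromℤ ((ℤ.- i) ℤ.* j) ≈ fromℤ (ℤ.- i) * fromℤ j
    *-homo-negˡ i j eq = begin
      fromℤ ((ℤ.- i) ℤ.* j)     ≡⟨ ≡.cong fromℤ (ℤ.neg-distribˡ-* i j) ⟨
      fromℤ (ℤ.- (i ℤ.* j))     ≈⟨ fromℤ-neg (i ℤ.* j) ⟩
      - fromℤ (i ℤ.* j)         ≈⟨ -‿cong eq ⟩
      - (fromℤ i * fromℤ j)     ≈⟨ -‿distribˡ-* _ _ ⟩
      - fromℤ i * fromℤ j       ≈⟨ *-congʳ (fromℤ-neg i) ⟨
      fromℤ (ℤ.- i) * fromℤ j   ∎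

  fromℤ-* : ∀ i j → fromℤ (i ℤ.* j) ≈ fromℤ i * fromℤ j
  fromℤ-* (+ m)    (+ n)    = *-pos-homo m n
  fromℤ-* (+ m)    -[1+ n ] = *-homo-negʳ (+ m) (+ suc n) (*-pos-homo m (suc n))
  fromℤ-* -[1+ m ] (+ n)    = *-homo-negˡ (+ suc m) (+ n) (*-pos-homo (suc m) n)
  fromℤ-* -[1+ m ] -[1+ n ] = *-homo-negˡ (+ suc m) -[1+ n ] (fromℤ-* (+ suc m) -[1+ n ])

  private
    morphism : ℤ.+-*-rawRing -Raw-AlmostCommutative⟶ fromCommutativeRing R
    morphism = record
      { ⟦_⟧    = fromℤ
      ; +-homo = fromℤ-+
      ; *-homo = fromℤ-*
      ; -‿homo = fromℤ-neg
      ; 0-homo = refl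
      ; 1-homo = +-identityʳ 1#
      }

    _≟_ : ∀ i j → Maybe (fromℤ i ≈ fromℤ j)
    i ≟ j with i ℤ.≟ j
    ... | yes i≡j = just (reflexive (≡.cong fromℤ i≡j))
    ... | no  _   = nothing

  open RingSolver ℤ.+-*-rawRing (fromCommutativeRing R) morphism _≟_ public
    using (solve; _:=_; _:+_; _:*_; _:-_; :-_; con)

-- Arithmetic of inequalities in an ordered field.

module OrderedField (ℝ : CompleteOrderedField) where
  open CompleteOrderedField ℝ hiding (zero)
  open IntegerSolver commutativeRing
  open IsStrictTotalOrder isStrictTotalOrder public
    using (compare; _≟_; <-resp-≈)
    renaming (trans to <-trans; irrefl to <-irrefl)
  private module ≤-Props = ToNonStrict _≈_ _<_
  open RingProperties ring public using (-0#≈0#)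

  ≤-trans : ∀ {x y z} → x ≤ y → y ≤ z → x ≤ z
  ≤-trans = ≤-Props.trans isEquivalence <-resp-≈ <-trans

  <-≤-trans : ∀ {x y z} → x < y → y ≤ z → x < z
  <-≤-trans = ≤-Props.<-≤-trans <-trans (proj₁ <-resp-≈)

  ≤-<-trans : ∀ {x y z} → x ≤ y → y < z → x < z
  ≤-<-trans = ≤-Props.≤-<-trans sym <-trans (proj₂ <-resp-≈)

  ≤-refl : ∀ {x} → x ≤ x
  ≤-refl = inj₂ refl

  ≤-antisym : ∀ {x y} → x ≤ y → y ≤ x → x ≈ y
  ≤-antisym = ≤-Props.antisym isEquivalence <-trans <-irrefl

  <-respʳ : ∀ {x y z} → y ≈ z → x < y → x < z
  <-respʳ = proj₁ <-resp-≈

  <-respˡ : ∀ {x y z} → y ≈ z → y < x → z < x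
  <-respˡ = proj₂ <-resp-≈

  ≤-respʳ : ∀ {x y z} → y ≈ z → x ≤ y → x ≤ z
  ≤-respʳ y≈z x≤y = ≤-trans x≤y (inj₂ y≈z)

  ≤-respˡ : ∀ {x y z} → y ≈ z → y ≤ x → z ≤ x
  ≤-respˡ y≈z y≤x = ≤-trans (inj₂ (sym y≈z)) y≤x

  <⇒≱ : ∀ {x y} → x < y → ¬ y ≤ x
  <⇒≱ x<y y≤x = <-irrefl refl (<-≤-trans x<y y≤x)

  ≤-<-total : ∀ x y → x ≤ y ⊎ y < x
  ≤-<-total x y with compare x y
  ... | tri< x<y _ _ = inj₁ (inj₁ x<y)
  ... | tri≈ _ x≈y _ = inj₁ (inj₂ x≈y)
  ... | tri> _ _ y<x = inj₂ y<x

  ≮⇒≥ : ∀ {x y} → ¬ x < y → y ≤ x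
  ≮⇒≥ {x} {y} x≮y with ≤-<-total y x
  ... | inj₁ y≤x = y≤x
  ... | inj₂ x<y = ⊥-elim (x≮y x<y)

  ≤∧≉⇒< : ∀ {x y} → x ≤ y → ¬ x ≈ y → x < y
  ≤∧≉⇒< (inj₁ x<y) _   = x<y
  ≤∧≉⇒< (inj₂ x≈y) x≉y = ⊥-elim (x≉y x≈y)

  x<y⇒0<y-x : ∀ {x y} → x < y → 0# < y - x
  x<y⇒0<y-x {x} x<y = <-respˡ (-‿inverseʳ x) (+-monoˡ-< (- x) x<y)

  x≤y⇒0≤y-x : ∀ {x y} → x ≤ y → 0# ≤ y - x
  x≤y⇒0≤y-x     (inj₁ x<y) = inj₁ (x<y⇒0<y-x x<y)
  x≤y⇒0≤y-x {x} (inj₂ x≈y) = inj₂ (trans (sym (-‿inverseʳ x)) (+-congʳ x≈y))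

  -- Inequalities below are mostly proved in this form: y - x is rewritten as an evidently positive
  -- expression, and the identity is left to the ring solver.
  0<d⇒x<y : ∀ {d x y} → 0# < d → d ≈ y - x → x < y
  0<d⇒x<y {d} {x} {y} 0<d d≈y-x = <-respˡ (+-identityˡ x)
    (<-respʳ (trans (+-congʳ d≈y-x) (solve 2 (λ x y → (y :- x) :+ x := y) refl x y))
      (+-monoˡ-< x 0<d))

  0≤d⇒x≤y : ∀ {d x y} → 0# ≤ d → d ≈ y - x → x ≤ y
  0≤d⇒x≤y         (inj₁ 0<d) eq = inj₁ (0<d⇒x<y 0<d eq)
  0≤d⇒x≤y {d} {x} {y} (inj₂ 0≈d) eq = inj₂ (begin
    x            ≈⟨ +-identityˡ x ⟨
    0# + x       ≈⟨ +-congʳ (trans 0≈d eq) ⟩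
    (y - x) + x  ≈⟨ solve 2 (λ x y → (y :- x) :+ x := y) refl x y ⟩
    y            ∎)
    where open SetoidReasoning setoid

  x<0⇒0<-x : ∀ {x} → x < 0# → 0# < - x
  x<0⇒0<-x {x} x<0 = <-respʳ (+-identityˡ (- x)) (x<y⇒0<y-x x<0)

  x≤0⇒0≤-x : ∀ {x} → x ≤ 0# → 0# ≤ - x
  x≤0⇒0≤-x {x} x≤0 = ≤-respʳ (+-identityˡ (- x)) (x≤y⇒0≤y-x x≤0)

  +-pos-nonneg : ∀ {x y} → 0# < x → 0# ≤ y → 0# < x + y
  +-pos-nonneg {x} {y} 0<x 0≤y = ≤-<-trans 0≤y
    (<-respˡ (+-identityˡ y) (+-monoˡ-< y 0<x))

  +-nonneg : ∀ {x y} → 0# ≤ x → 0# ≤ y → 0# ≤ x + y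
  +-nonneg         (inj₁ 0<x) 0≤y = inj₁ (+-pos-nonneg 0<x 0≤y)
  +-nonneg {x} {y} (inj₂ 0≈x) 0≤y = ≤-respʳ (trans (sym (+-identityˡ y)) (+-congʳ 0≈x)) 0≤y

  *-nonneg : ∀ {x y} → 0# ≤ x → 0# ≤ y → 0# ≤ x * y
  *-nonneg         (inj₁ 0<x) (inj₁ 0<y) = inj₁ (*-pos 0<x 0<y)
  *-nonneg {x} {y} (inj₁ _)   (inj₂ 0≈y) = inj₂ (sym (trans (*-congˡ (sym 0≈y)) (zeroʳ x)))
  *-nonneg {x} {y} (inj₂ 0≈x) _          = inj₂ (sym (trans (*-congʳ (sym 0≈x)) (zeroˡ y)))

  neg*neg⇒pos : ∀ {x y} → x < 0# → y < 0# → 0# < x * y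
  neg*neg⇒pos {x} {y} x<0 y<0 = <-respʳ
    (solve 2 (λ x y → (:- x) :* (:- y) := x :* y) refl x y)
    (*-pos (x<0⇒0<-x x<0) (x<0⇒0<-x y<0))

  pos*neg⇒neg : ∀ {x y} → 0# < x → y < 0# → x * y < 0#
  pos*neg⇒neg {x} {y} 0<x y<0 = 0<d⇒x<y (*-pos 0<x (x<0⇒0<-x y<0))
    (solve 2 (λ x y → x :* (:- y) := con (+ 0) :- x :* y) refl x y)

  0<1 : 0# < 1#
  0<1 with compare 0# 1#
  ... | tri< 0<1 _ _ = 0<1
  ... | tri≈ _ 0≈1 _ = ⊥-elim (0≉1 0≈1)
  ... | tri> _ _ 1<0 = <-respʳ (*-identityʳ 1#) (neg*neg⇒pos 1<0 1<0)

  pos-factorʳ : ∀ {x y} → 0# < x → 0# < x * y → 0# < y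
  pos-factorʳ {x} {y} 0<x 0<xy with compare 0# y
  ... | tri< 0<y _ _ = 0<y
  ... | tri≈ _ 0≈y _ = ⊥-elim (<-irrefl (sym (trans (*-congˡ (sym 0≈y)) (zeroʳ x))) 0<xy)
  ... | tri> _ _ y<0 = ⊥-elim (<-irrefl refl (<-trans 0<xy (pos*neg⇒neg 0<x y<0)))

  inverse-pos : ∀ {x} → 0# < x → ∃[ y ] 0# < y × x * y ≈ 1#
  inverse-pos {x} 0<x with inverse x (λ x≈0 → <-irrefl (sym x≈0) 0<x)
  ... | y , xy≈1 = y , pos-factorʳ 0<x (<-respʳ (sym xy≈1) 0<1) , xy≈1

  no-zero-divisors : ∀ {x y} → ¬ x ≈ 0# → x * y ≈ 0# → y ≈ 0#
  no-zero-divisors {x} {y} x≉0 xy≈0 with inverse x x≉0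
  ... | x⁻¹ , xx⁻¹≈1 = begin
    y                ≈⟨ *-identityˡ y ⟨
    1# * y           ≈⟨ *-congʳ xx⁻¹≈1 ⟨
    (x * x⁻¹) * y    ≈⟨ solve 3 (λ x y z → (x :* z) :* y := (x :* y) :* z) refl x y x⁻¹ ⟩
    (x * y) * x⁻¹    ≈⟨ *-congʳ xy≈0 ⟩
    0# * x⁻¹         ≈⟨ zeroˡ x⁻¹ ⟩
    0#               ∎
    where open SetoidReasoning setoid

  0≤x+x⇒0≤x : ∀ {x} → 0# ≤ x + x → 0# ≤ x
  0≤x+x⇒0≤x {x} 0≤x+x = ≮⇒≥ λ x<0 → <⇒≱
    (+-pos-nonneg (x<0⇒0<-x x<0) (inj₁ (x<0⇒0<-x x<0)))
    (0≤d⇒x≤y 0≤x+x (solve 1 (λ x → x :+ x := con (+ 0) :- (:- x :+ :- x)) refl x))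

-- Coefficients of sums, products and multiples of X - a.

module RealPolynomials (ℝ : CompleteOrderedField) where
  open CompleteOrderedField ℝ hiding (zero)
  open Polynomials ℝ
  open IntegerSolver commutativeRing
  open OrderedField ℝ
  open SetoidReasoning setoid

  ≈ₚ-sym : ∀ {p q} → p ≈ₚ q → q ≈ₚ p
  ≈ₚ-sym p≈q k = sym (p≈q k)

  coeff-+ : ∀ p q k → coeff (p +ₚ q) k ≈ coeff p k + coeff q k
  coeff-+ []      q       k       = sym (+-identityˡ _)
  coeff-+ (a ∷ p) []      k       = sym (+-identityʳ _)
  coeff-+ (a ∷ p) (b ∷ q) zero    = refl
  coeff-+ (a ∷ p) (b ∷ q) (suc k) = coeff-+ p q k

  coeff-scale : ∀ c p k → coeff (map (c *_) p) k ≈ c * coeff p k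
  coeff-scale c []      k       = sym (zeroʳ c)
  coeff-scale c (a ∷ p) zero    = refl
  coeff-scale c (a ∷ p) (suc k) = coeff-scale c p k

  coeff-* : ∀ a p q k → coeff ((a ∷ p) *ₚ q) k ≈ a * coeff q k + coeff (0# ∷ p *ₚ q) k
  coeff-* a p q k = trans (coeff-+ (map (a *_) q) _ k) (+-congʳ (coeff-scale a q k))

  coeff-C : ∀ c p k → coeff (C c *ₚ p) k ≈ c * coeff p k
  coeff-C c p zero    = trans (coeff-* c [] p zero) (+-identityʳ _)
  coeff-C c p (suc k) = trans (coeff-* c [] p (suc k)) (+-identityʳ _)

  *ₚ-congˡ : ∀ p {q s} → q ≈ₚ s → p *ₚ q ≈ₚ p *ₚ s
  *ₚ-congˡ []      q≈s k = refl
  *ₚ-congˡ (a ∷ p) {q} {s} q≈s k = begin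
    coeff ((a ∷ p) *ₚ q) k                   ≈⟨ coeff-* a p q k ⟩
    a * coeff q k + coeff (0# ∷ p *ₚ q) k    ≈⟨ +-cong (*-congˡ (q≈s k)) (shift k) ⟩
    a * coeff s k + coeff (0# ∷ p *ₚ s) k    ≈⟨ coeff-* a p s k ⟨
    coeff ((a ∷ p) *ₚ s) k                   ∎
    where
    shift : 0# ∷ p *ₚ q ≈ₚ 0# ∷ p *ₚ s
    shift zero    = refl
    shift (suc k) = *ₚ-congˡ p {q} {s} q≈s k

  infixr 8 [X-_]_
  [X-_]_ : Carrier → Poly → Poly
  [X- a ] p = (X +ₚ C (- a)) *ₚ p

  [X-]-cong : ∀ a {p q} → p ≈ₚ q → [X- a ] p ≈ₚ [X- a ] q
  [X-]-cong a {p} {q} = *ₚ-congˡ (X +ₚ C (- a)) {p} {q}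

  coeff-[X-]-zero : ∀ a p → coeff ([X- a ] p) 0 ≈ - (a * coeff p 0)
  coeff-[X-]-zero a p = trans (coeff-* (0# + - a) (1# ∷ []) p 0)
    (solve 2 (λ a c → (con (+ 0) :+ :- a) :* c :+ con (+ 0) := :- (a :* c)) refl a (coeff p 0))

  coeff-[X-]-suc : ∀ a p k →
    coeff ([X- a ] p) (suc k) ≈ coeff p k - a * coeff p (suc k)
  coeff-[X-]-suc a p k = begin
    coeff ([X- a ] p) (suc k)
      ≈⟨ coeff-* (0# + - a) (1# ∷ []) p (suc k) ⟩
    (0# + - a) * coeff p (suc k) + coeff (C 1# *ₚ p) k
      ≈⟨ +-congˡ (trans (coeff-C 1# p k) (*-identityˡ _)) ⟩
    (0# + - a) * coeff p (suc k) + coeff p k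
      ≈⟨ solve 3 (λ a c d → (con (+ 0) :+ :- a) :* c :+ d := d :- a :* c) refl
           a (coeff p (suc k)) (coeff p k) ⟩
    coeff p k - a * coeff p (suc k) ∎

  [X-]-congᵃ : ∀ {a b} p → a ≈ b → [X- a ] p ≈ₚ [X- b ] p
  [X-]-congᵃ {a} {b} p a≈b zero = trans (coeff-[X-]-zero a p)
    (trans (-‿cong (*-congʳ a≈b)) (sym (coeff-[X-]-zero b p)))
  [X-]-congᵃ {a} {b} p a≈b (suc k) = trans (coeff-[X-]-suc a p k)
    (trans (+-congˡ (-‿cong (*-congʳ a≈b))) (sym (coeff-[X-]-suc b p k)))

  [X-]-comm : ∀ a b p → [X- a ] [X- b ] p ≈ₚ [X- b ] [X- a ] p
  [X-]-comm a b p zero = begin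
    coeff ([X- a ] [X- b ] p) 0   ≈⟨ expand a b ⟩
    a * (b * coeff p 0)           ≈⟨ solve 3 (λ a b c → a :* (b :* c) := b :* (a :* c)) refl
                                       a b (coeff p 0) ⟩
    b * (a * coeff p 0)           ≈⟨ expand b a ⟨
    coeff ([X- b ] [X- a ] p) 0   ∎
    where
    expand : ∀ a b → coeff ([X- a ] [X- b ] p) 0 ≈ a * (b * coeff p 0)
    expand a b = trans (coeff-[X-]-zero a ([X- b ] p))
      (trans (-‿cong (*-congˡ (coeff-[X-]-zero b p)))
        (solve 2 (λ a c → :- (a :* :- c) := a :* c) refl a (b * coeff p 0)))
  [X-]-comm a b p (suc zero) = begin
    coeff ([X- a ] [X- b ] p) 1
      ≈⟨ expand a b ⟩
    - (b * coeff p 0) - a * (coeff p 0 - b * coeff p 1)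
      ≈⟨ solve 4 (λ a b c d → :- (b :* c) :- a :* (c :- b :* d) :=
                              :- (a :* c) :- b :* (c :- a :* d)) refl
           a b (coeff p 0) (coeff p 1) ⟩
    - (a * coeff p 0) - b * (coeff p 0 - a * coeff p 1)
      ≈⟨ expand b a ⟨
    coeff ([X- b ] [X- a ] p) 1 ∎
    where
    expand : ∀ a b → coeff ([X- a ] [X- b ] p) 1 ≈
             - (b * coeff p 0) - a * (coeff p 0 - b * coeff p 1)
    expand a b = trans (coeff-[X-]-suc a ([X- b ] p) 0)
      (+-cong (coeff-[X-]-zero b p) (-‿cong (*-congˡ (coeff-[X-]-suc b p 0))))
  [X-]-comm a b p (suc (suc k)) = begin
    coeff ([X- a ] [X- b ] p) (suc (suc k))
      ≈⟨ expand a b ⟩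
    (coeff p k - b * coeff p (1 ℕ.+ k)) - a * (coeff p (1 ℕ.+ k) - b * coeff p (2 ℕ.+ k))
      ≈⟨ solve 5 (λ a b c d e → (c :- b :* d) :- a :* (d :- b :* e) :=
                                (c :- a :* d) :- b :* (d :- a :* e)) refl
           a b (coeff p k) (coeff p (1 ℕ.+ k)) (coeff p (2 ℕ.+ k)) ⟩
    (coeff p k - a * coeff p (1 ℕ.+ k)) - b * (coeff p (1 ℕ.+ k) - a * coeff p (2 ℕ.+ k))
      ≈⟨ expand b a ⟨
    coeff ([X- b ] [X- a ] p) (suc (suc k)) ∎
    where
    expand : ∀ a b → coeff ([X- a ] [X- b ] p) (suc (suc k)) ≈
      (coeff p k - b * coeff p (1 ℕ.+ k)) - a * (coeff p (1 ℕ.+ k) - b * coeff p (2 ℕ.+ k))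
    expand a b = trans (coeff-[X-]-suc a ([X- b ] p) (suc k))
      (+-cong (coeff-[X-]-suc b p k) (-‿cong (*-congˡ (coeff-[X-]-suc b p (suc k)))))

  [X-]-distrib-+ : ∀ a p q → [X- a ] (p +ₚ q) ≈ₚ [X- a ] p +ₚ [X- a ] q
  [X-]-distrib-+ a p q zero = begin
    coeff ([X- a ] (p +ₚ q)) 0
      ≈⟨ trans (coeff-[X-]-zero a (p +ₚ q)) (-‿cong (*-congˡ (coeff-+ p q 0))) ⟩
    - (a * (coeff p 0 + coeff q 0))
      ≈⟨ solve 3 (λ a c d → :- (a :* (c :+ d)) := :- (a :* c) :+ :- (a :* d)) refl
           a (coeff p 0) (coeff q 0) ⟩
    - (a * coeff p 0) + - (a * coeff q 0)
      ≈⟨ +-cong (coeff-[X-]-zero a p) (coeff-[X-]-zero a q) ⟨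
    coeff ([X- a ] p) 0 + coeff ([X- a ] q) 0
      ≈⟨ coeff-+ ([X- a ] p) ([X- a ] q) 0 ⟨
    coeff ([X- a ] p +ₚ [X- a ] q) 0 ∎
  [X-]-distrib-+ a p q (suc k) = begin
    coeff ([X- a ] (p +ₚ q)) (suc k)
      ≈⟨ coeff-[X-]-suc a (p +ₚ q) k ⟩
    coeff (p +ₚ q) k - a * coeff (p +ₚ q) (suc k)
      ≈⟨ +-cong (coeff-+ p q k) (-‿cong (*-congˡ (coeff-+ p q (suc k)))) ⟩
    (coeff p k + coeff q k) - a * (coeff p (suc k) + coeff q (suc k))
      ≈⟨ solve 5 (λ a c d e f → (c :+ d) :- a :* (e :+ f) := (c :- a :* e) :+ (d :- a :* f)) refl
           a (coeff p k) (coeff q k) (coeff p (suc k)) (coeff q (suc k)) ⟩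
    (coeff p k - a * coeff p (suc k)) + (coeff q k - a * coeff q (suc k))
      ≈⟨ +-cong (coeff-[X-]-suc a p k) (coeff-[X-]-suc a q k) ⟨
    coeff ([X- a ] p) (suc k) + coeff ([X- a ] q) (suc k)
      ≈⟨ coeff-+ ([X- a ] p) ([X- a ] q) (suc k) ⟨
    coeff ([X- a ] p +ₚ [X- a ] q) (suc k) ∎

  coeff-finite : ∀ p → ∃[ n ] ∀ k → n ℕ.≤ k → coeff p k ≈ 0#
  coeff-finite []      = 0 , λ _ _ → refl
  coeff-finite (a ∷ p) with coeff-finite p
  ... | n , vanish = suc n , λ { (suc k) (s≤s n≤k) → vanish k n≤k }

  -- Coefficient k of p is coefficient k + 1 of (X - a) p plus a times coefficient k + 1 of p. Since
  -- p and q vanish far out, equality descends from there. The lower end N lets the same argument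
  -- bound the degree of a quotient.
  [X-]-cancel-from : ∀ a p q N →
    (∀ k → N ℕ.≤ k → coeff ([X- a ] p) (suc k) ≈ coeff ([X- a ] q) (suc k)) →
    ∀ k → N ℕ.≤ k → coeff p k ≈ coeff q k
  [X-]-cancel-from a p q N eq k = ascend (m ℕ.+ n) k (ℕ.m≤m+n (m ℕ.+ n) k)
    where
    m = proj₁ (coeff-finite p)
    n = proj₁ (coeff-finite q)
    p-vanish = proj₂ (coeff-finite p)
    q-vanish = proj₂ (coeff-finite q)

    recover : ∀ s k → coeff s k ≈ coeff ([X- a ] s) (suc k) + a * coeff s (suc k)
    recover s k = trans
      (solve 3 (λ a c d → c := (c :- a :* d) :+ a :* d) refl a (coeff s k) (coeff s (suc k)))
      (+-congʳ (sym (coeff-[X-]-suc a s k)))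

    -- Both polynomials vanish from m + n on; d bounds the distance from k up to that point.
    ascend : ∀ d k → m ℕ.+ n ℕ.≤ d ℕ.+ k → N ℕ.≤ k → coeff p k ≈ coeff q k
    ascend zero    k m+n≤k N≤k = trans (p-vanish k (ℕ.≤-trans (ℕ.m≤m+n m n) m+n≤k))
      (sym (q-vanish k (ℕ.≤-trans (ℕ.m≤n+m n m) m+n≤k)))
    ascend (suc d) k m+n≤ N≤k = begin
      coeff p k                                       ≈⟨ recover p k ⟩
      coeff ([X- a ] p) (suc k) + a * coeff p (suc k)
        ≈⟨ +-cong (eq k N≤k) (*-congˡ (ascend d (suc k)
             (ℕ.≤-trans m+n≤ (ℕ.≤-reflexive (≡.sym (ℕ.+-suc d k)))) (ℕ.m≤n⇒m≤1+n N≤k))) ⟩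
      coeff ([X- a ] q) (suc k) + a * coeff q (suc k) ≈⟨ recover q k ⟨
      coeff q k                                       ∎

  [X-]-cancel : ∀ a p q → [X- a ] p ≈ₚ [X- a ] q → p ≈ₚ q
  [X-]-cancel a p q eq k = [X-]-cancel-from a p q 0 (λ k _ → eq (suc k)) k z≤n

  -- Evaluation and division by a linear factor.

  eval : Poly → Carrier → Carrier
  eval []      t = 0#
  eval (a ∷ p) t = a + t * eval p t

  eval-congʳ : ∀ p {s t} → s ≈ t → eval p s ≈ eval p t
  eval-congʳ []      s≈t = refl
  eval-congʳ (a ∷ p) s≈t = +-congˡ (*-cong s≈t (eval-congʳ p s≈t))

  eval-≈0 : ∀ p t → p ≈ₚ 0ₚ → eval p t ≈ 0#
  eval-≈0 []      t p≈0 = refl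
  eval-≈0 (a ∷ p) t p≈0 = trans
    (+-cong (p≈0 0) (trans (*-congˡ (eval-≈0 p t (λ k → p≈0 (suc k)))) (zeroʳ t)))
    (+-identityʳ 0#)

  eval-congˡ : ∀ {p q} → p ≈ₚ q → ∀ t → eval p t ≈ eval q t
  eval-congˡ {[]}    {q}     p≈q t = sym (eval-≈0 q t (≈ₚ-sym {0ₚ} {q} p≈q))
  eval-congˡ {a ∷ p} {[]}    p≈q t = eval-≈0 (a ∷ p) t p≈q
  eval-congˡ {a ∷ p} {b ∷ q} p≈q t =
    +-cong (p≈q 0) (*-congˡ (eval-congˡ {p} {q} (λ k → p≈q (suc k)) t))

  eval-+ : ∀ p q t → eval (p +ₚ q) t ≈ eval p t + eval q t
  eval-+ []      q       t = sym (+-identityˡ _)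
  eval-+ (a ∷ p) []      t = sym (+-identityʳ _)
  eval-+ (a ∷ p) (b ∷ q) t = trans (+-congˡ (*-congˡ (eval-+ p q t)))
    (solve 5 (λ a b t P Q → (a :+ b) :+ t :* (P :+ Q) := (a :+ t :* P) :+ (b :+ t :* Q)) refl
      a b t (eval p t) (eval q t))

  eval-scale : ∀ c p t → eval (map (c *_) p) t ≈ c * eval p t
  eval-scale c []      t = sym (zeroʳ c)
  eval-scale c (a ∷ p) t = trans (+-congˡ (*-congˡ (eval-scale c p t)))
    (solve 4 (λ c a t P → c :* a :+ t :* (c :* P) := c :* (a :+ t :* P)) refl c a t (eval p t))

  eval-* : ∀ p q t → eval (p *ₚ q) t ≈ eval p t * eval q t
  eval-* []      q t = sym (zeroˡ _)
  eval-* (a ∷ p) q t = begin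
    eval (map (a *_) q +ₚ (0# ∷ p *ₚ q)) t
      ≈⟨ eval-+ (map (a *_) q) (0# ∷ p *ₚ q) t ⟩
    eval (map (a *_) q) t + (0# + t * eval (p *ₚ q) t)
      ≈⟨ +-cong (eval-scale a q t) (+-congˡ (*-congˡ (eval-* p q t))) ⟩
    a * eval q t + (0# + t * (eval p t * eval q t))
      ≈⟨ solve 4 (λ a t P Q → a :* Q :+ (con (+ 0) :+ t :* (P :* Q)) := (a :+ t :* P) :* Q) refl
           a t (eval p t) (eval q t) ⟩
    (a + t * eval p t) * eval q t ∎

  eval-C : ∀ c t → eval (C c) t ≈ c
  eval-C c t = trans (+-congˡ (zeroʳ t)) (+-identityʳ c)

  eval-[X-] : ∀ a p t → eval ([X- a ] p) t ≈ (t - a) * eval p t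
  eval-[X-] a p t = trans (eval-* (X +ₚ C (- a)) p t) (*-congʳ
    (trans (+-congˡ (*-congˡ (trans (+-congˡ (zeroʳ t)) (+-identityʳ 1#))))
      (trans (+-congˡ (*-identityʳ t))
        (solve 2 (λ a t → (con (+ 0) :+ :- a) :+ t := t :- a) refl a t))))

  eval-≈[X-] : ∀ {p} a q → p ≈ₚ [X- a ] q → ∀ t → eval p t ≈ (t - a) * eval q t
  eval-≈[X-] {p} a q p≈ t = trans (eval-congˡ {p} {[X- a ] q} p≈ t) (eval-[X-] a q t)

  -- Synthetic division by X - a: the k-th coefficient of the quotient is the
  -- value at a of what remains of p after removing its first k + 1 coefficients.
  quotient : Poly → Carrier → Poly
  quotient []      a = []
  quotient (c ∷ p) a = eval p a ∷ quotient p a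

  division : ∀ p a → p ≈ₚ C (eval p a) +ₚ [X- a ] quotient p a
  division p a k = trans (by-coefficient p k)
    (sym (coeff-+ (C (eval p a)) ([X- a ] quotient p a) k))
    where
    by-coefficient : ∀ p k → coeff p k ≈ coeff (C (eval p a)) k + coeff ([X- a ] quotient p a) k
    by-coefficient []      zero    = sym (trans (+-congˡ (coeff-[X-]-zero a []))
      (solve 1 (λ a → con (+ 0) :+ :- (a :* con (+ 0)) := con (+ 0)) refl a))
    by-coefficient []      (suc k) = sym (trans (+-congˡ (coeff-[X-]-suc a [] k))
      (solve 1 (λ a → con (+ 0) :+ (con (+ 0) :- a :* con (+ 0)) := con (+ 0)) refl a))
    by-coefficient (c ∷ p) zero    = sym (trans (+-congˡ (coeff-[X-]-zero a (quotient (c ∷ p) a)))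
      (solve 3 (λ c a e → (c :+ a :* e) :+ :- (a :* e) := c) refl c a (eval p a)))
    by-coefficient (c ∷ p) (suc k) = sym (trans
      (+-congˡ (coeff-[X-]-suc a (quotient (c ∷ p) a) k)) (step k (by-coefficient p k)))
      where
      step : ∀ k → coeff p k ≈ coeff (C (eval p a)) k + coeff ([X- a ] quotient p a) k →
        0# + (coeff (eval p a ∷ quotient p a) k - a * coeff (quotient p a) k) ≈ coeff p k
      step zero eq = begin
        0# + (eval p a - a * coeff (quotient p a) 0)
          ≈⟨ solve 2 (λ e u → con (+ 0) :+ (e :- u) := e :+ :- u) refl _ _ ⟩
        eval p a + - (a * coeff (quotient p a) 0)
          ≈⟨ +-congˡ (coeff-[X-]-zero a (quotient p a)) ⟨
        eval p a + coeff ([X- a ] quotient p a) 0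
          ≈⟨ eq ⟨
        coeff p 0 ∎
      step (suc k) eq = trans (+-congˡ (sym (coeff-[X-]-suc a (quotient p a) k))) (sym eq)

  factor : ∀ p a → eval p a ≈ 0# → p ≈ₚ [X- a ] quotient p a
  factor p a pa≈0 k = begin
    coeff p k                                                   ≈⟨ division p a k ⟩
    coeff (C (eval p a) +ₚ [X- a ] quotient p a) k              ≈⟨ coeff-+ (C (eval p a)) ([X- a ] quotient p a) k ⟩
    coeff (C (eval p a)) k + coeff ([X- a ] quotient p a) k     ≈⟨ +-congʳ (constant k) ⟩
    0# + coeff ([X- a ] quotient p a) k                         ≈⟨ +-identityˡ _ ⟩
    coeff ([X- a ] quotient p a) k                              ∎
    where
    constant : ∀ k → coeff (C (eval p a)) k ≈ 0#
    constant zero    = pa≈0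
    constant (suc k) = refl

  eval-near : ∀ p a t → eval p t ≈ eval p a + (t - a) * eval (quotient p a) t
  eval-near p a t = trans (eval-congˡ {p} {C (eval p a) +ₚ [X- a ] quotient p a} (division p a) t)
    (trans (eval-+ (C (eval p a)) ([X- a ] quotient p a) t)
      (+-cong (eval-C (eval p a) t) (eval-[X-] a (quotient p a) t)))

  -- Bounds on intervals and the intermediate value theorem.

  absolute-bound : ∀ c → ∃[ N ] c ≤ N × - c ≤ N
  absolute-bound c with ≤-<-total 0# c
  ... | inj₁ 0≤c = c , ≤-refl ,
    0≤d⇒x≤y (+-nonneg 0≤c 0≤c) (solve 1 (λ c → c :+ c := c :- :- c) refl c)
  ... | inj₂ c<0 = - c ,
    inj₁ (0<d⇒x<y (+-pos-nonneg (x<0⇒0<-x c<0) (inj₁ (x<0⇒0<-x c<0)))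
      (solve 1 (λ c → :- c :+ :- c := :- c :- c) refl c)) ,
    ≤-refl

  -- No case distinction on signs: (K - x)(M + y) + (K + x)(M - y) = 2 (K M - x y), and all four
  -- factors are nonnegative.
  *-bound : ∀ {x y K M} → x ≤ K → - x ≤ K → y ≤ M → - y ≤ M → x * y ≤ K * M
  *-bound {x} {y} {K} {M} x≤K -x≤K y≤M -y≤M = 0≤d⇒x≤y
    (0≤x+x⇒0≤x (≤-respʳ
      (solve 4 (λ x y K M → (K :- x) :* (M :- :- y) :+ (K :- :- x) :* (M :- y) :=
                            (K :* M :- x :* y) :+ (K :* M :- x :* y)) refl x y K M)
      (+-nonneg (*-nonneg (x≤y⇒0≤y-x x≤K) (x≤y⇒0≤y-x -y≤M))
                (*-nonneg (x≤y⇒0≤y-x -x≤K) (x≤y⇒0≤y-x y≤M)))))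
    refl

  +-mono-≤ : ∀ {a b c d} → a ≤ b → c ≤ d → a + c ≤ b + d
  +-mono-≤ {a} {b} {c} {d} a≤b c≤d = 0≤d⇒x≤y (+-nonneg (x≤y⇒0≤y-x a≤b) (x≤y⇒0≤y-x c≤d))
    (solve 4 (λ a b c d → (b :- a) :+ (d :- c) := (b :+ d) :- (a :+ c)) refl a b c d)

  eval-bounded : ∀ p K → ∃[ M ] ∀ x → x ≤ K → - x ≤ K → eval p x ≤ M × - eval p x ≤ M
  eval-bounded []      K = 0# , λ x _ _ → ≤-refl , inj₂ -0#≈0#
  eval-bounded (c ∷ p) K with absolute-bound c | eval-bounded p K
  ... | N , c≤N , -c≤N | M , bound = N + K * M , λ x x≤K -x≤K →
    let lower = proj₁ (bound x x≤K -x≤K) ; upper = proj₂ (bound x x≤K -x≤K) in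
    +-mono-≤ c≤N (*-bound x≤K -x≤K lower upper) ,
    ≤-respˡ (solve 3 (λ c x P → :- c :+ (:- x) :* P := :- (c :+ x :* P)) refl c x (eval p x))
      (+-mono-≤ -c≤N (*-bound -x≤K
        (≤-respˡ (solve 1 (λ x → x := :- :- x) refl x) x≤K) lower upper))

  neg-antitone : ∀ {x y} → x ≤ y → - y ≤ - x
  neg-antitone {x} {y} x≤y = 0≤d⇒x≤y (x≤y⇒0≤y-x x≤y)
    (solve 2 (λ x y → y :- x := :- x :- :- y) refl x y)

  -- M is made positive because the intermediate value theorem divides by it.
  eval-bounded-above : ∀ p s t → ∃[ M ] 0# < M × (∀ x → s ≤ x → x ≤ t → eval p x ≤ M)
  eval-bounded-above p s t with radius
    where
    radius : ∃[ K ] t ≤ K × - s ≤ K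
    radius with ≤-<-total t (- s)
    ... | inj₁ t≤-s = - s , t≤-s , ≤-refl
    ... | inj₂ -s<t = t , ≤-refl , inj₁ -s<t
  ... | K , t≤K , -s≤K with eval-bounded p K
  ... | M , bound with ≤-<-total M 0#
  ... | inj₁ M≤0 = 1# , 0<1 , λ x s≤x x≤t → ≤-trans
    (proj₁ (bound x (≤-trans x≤t t≤K) (≤-trans (neg-antitone s≤x) -s≤K)))
    (≤-trans M≤0 (inj₁ 0<1))
  ... | inj₂ 0<M = M , 0<M , λ x s≤x x≤t →
    proj₁ (bound x (≤-trans x≤t t≤K) (≤-trans (neg-antitone s≤x) -s≤K))

  -- The zero is the supremum a of the points of [s, t] where p is nonpositive. In place of
  -- continuity stands p(x) = p(a) + (x - a) q(x) with the quotient q at most M on [s, t]; this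
  -- one-sided bound serves on both sides of a.
  intermediate-value : ∀ p {s t} → s < t → eval p s < 0# → 0# < eval p t →
    ∃[ a ] s < a × a < t × eval p a ≈ 0#
  intermediate-value p {s} {t} s<t ps<0 0<pt = a , s<a , a<t , pa≈0
    where
    S : Carrier → Set
    S x = s ≤ x × x ≤ t × eval p x ≤ 0#

    supS : ∃[ a ] UpperBound S a × (∀ b → UpperBound S b → a ≤ b)
    supS = supremum S (s , ≤-refl , inj₁ s<t , inj₁ ps<0) (t , λ x x∈S → proj₁ (proj₂ x∈S))

    a : Carrier
    a = proj₁ supS

    s≤a : s ≤ a
    s≤a = proj₁ (proj₂ supS) s (≤-refl , inj₁ s<t , inj₁ ps<0)

    a≤t : a ≤ t
    a≤t = proj₂ (proj₂ supS) t λ x x∈S → proj₁ (proj₂ x∈S)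

    bound = eval-bounded-above (quotient p a) s t
    M = proj₁ bound
    0<M = proj₁ (proj₂ bound)
    M⁻¹ = proj₁ (inverse-pos 0<M)
    0<M⁻¹ = proj₁ (proj₂ (inverse-pos 0<M))

    MvM⁻¹ : ∀ v → M * (v * M⁻¹) ≈ v
    MvM⁻¹ v = trans (solve 3 (λ m v n → m :* (v :* n) := (m :* n) :* v) refl M v M⁻¹)
      (trans (*-congʳ (proj₂ (proj₂ (inverse-pos 0<M)))) (*-identityˡ v))

    not-positive : ¬ 0# < eval p a
    not-positive 0<pa = <⇒≱ a-δ<a (proj₂ (proj₂ supS) (a - δ) below)
      where
      -- For x in S the identity gives p(x) ≥ p(a) - M (a - x), which is positive while a - x is
      -- below p(a) / M. So a - δ would be a smaller upper bound.
      δ : Carrier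
      δ = eval p a * M⁻¹

      a-δ<a : a - δ < a
      a-δ<a = 0<d⇒x<y (*-pos 0<pa 0<M⁻¹) (solve 2 (λ a d → d := a :- (a :- d)) refl a δ)

      below : UpperBound S (a - δ)
      below x x∈S@(s≤x , x≤t , px≤0) = ≮⇒≥ λ a-δ<x → <⇒≱
        (<-respʳ
          (+-congʳ (MvM⁻¹ (eval p a)))
          (<-respʳ (solve 4 (λ x a d m → m :* (x :- (a :- d)) := m :* d :+ (x :- a) :* m) refl x a δ M)
            (*-pos 0<M (x<y⇒0<y-x a-δ<x))))
        (≤-trans
          (0≤d⇒x≤y
            (*-nonneg (x≤y⇒0≤y-x (proj₁ (proj₂ supS) x x∈S))
                      (x≤y⇒0≤y-x (proj₂ (proj₂ bound) x s≤x x≤t)))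
            (solve 5 (λ x a m q v → (a :- x) :* (m :- q) :=
                (v :+ (x :- a) :* q) :- (v :+ (x :- a) :* m)) refl
              x a M (eval (quotient p a) x) (eval p a)))
          (≤-respˡ (eval-near p a x) px≤0))

    not-negative : ¬ eval p a < 0#
    not-negative pa<0 = <⇒≱ a<a+ε (proj₁ (proj₂ supS) (a + ε) a+ε∈S)
      where
      v = eval p a

      0<t-a : 0# < t - a
      0<t-a = x<y⇒0<y-x (≤∧≉⇒< a≤t λ a≈t →
        <-irrefl refl (<-trans pa<0 (<-respʳ (eval-congʳ p (sym a≈t)) 0<pt)))

      -- ε is the smaller of t - a and -p(a) / M: the former keeps a + ε in the interval, the latter
      -- keeps p nonpositive there, so a + ε is a point of S above a.
      step : ∃[ ε ] 0# < ε × ε ≤ t - a × ε ≤ (- v) * M⁻¹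
      step with ≤-<-total (t - a) ((- v) * M⁻¹)
      ... | inj₁ le = t - a , 0<t-a , ≤-refl , le
      ... | inj₂ gt = (- v) * M⁻¹ , *-pos (x<0⇒0<-x pa<0) 0<M⁻¹ , inj₁ gt , ≤-refl

      ε = proj₁ step
      0<ε = proj₁ (proj₂ step)

      a<a+ε : a < a + ε
      a<a+ε = 0<d⇒x<y 0<ε (solve 2 (λ a e → e := (a :+ e) :- a) refl a ε)

      a+ε≤t : a + ε ≤ t
      a+ε≤t = 0≤d⇒x≤y (x≤y⇒0≤y-x (proj₁ (proj₂ (proj₂ step))))
        (solve 3 (λ a e t → (t :- a) :- e := t :- (a :+ e)) refl a ε t)

      s≤a+ε : s ≤ a + ε
      s≤a+ε = ≤-trans s≤a (inj₁ a<a+ε)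

      a+ε∈S : S (a + ε)
      a+ε∈S = s≤a+ε , a+ε≤t , ≤-respˡ (sym (eval-near p a (a + ε)))
        (0≤d⇒x≤y
          (+-nonneg
            (*-nonneg (inj₁ 0<ε) (x≤y⇒0≤y-x (proj₂ (proj₂ bound) (a + ε) s≤a+ε a+ε≤t)))
            (*-nonneg (inj₁ 0<M) (x≤y⇒0≤y-x (proj₂ (proj₂ (proj₂ step))))))
          (begin
            ε * (M - q) + M * ((- v) * M⁻¹ - ε)
              ≈⟨ solve 5 (λ e m q v n → e :* (m :- q) :+ m :* ((:- v) :* n :- e) :=
                    :- (m :* (v :* n)) :- e :* q) refl ε M q v M⁻¹ ⟩
            - (M * (v * M⁻¹)) - ε * q
              ≈⟨ +-congʳ (-‿cong (MvM⁻¹ v)) ⟩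
            - v - ε * q
              ≈⟨ solve 4 (λ a e q v → :- v :- e :* q :=
                    con (+ 0) :- (v :+ ((a :+ e) :- a) :* q)) refl a ε q v ⟩
            0# - (v + ((a + ε) - a) * q) ∎))
        where
        q = eval (quotient p a) (a + ε)

    pa≈0 : eval p a ≈ 0#
    pa≈0 with compare (eval p a) 0#
    ... | tri< pa<0 _ _ = ⊥-elim (not-negative pa<0)
    ... | tri≈ _ pa≈0 _ = pa≈0
    ... | tri> _ _ 0<pa = ⊥-elim (not-positive 0<pa)

    s<a : s < a
    s<a = ≤∧≉⇒< s≤a λ s≈a → <-irrefl (trans (eval-congʳ p s≈a) pa≈0) ps<0

    a<t : a < t
    a<t = ≤∧≉⇒< a≤t λ a≈t → <-irrefl (trans (sym pa≈0) (eval-congʳ p a≈t)) 0<pt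

-- Interlacing pairs as merged lists of zeros.

module InterlacingPairs (ℝ : CompleteOrderedField) where
  open CompleteOrderedField ℝ hiding (zero)
  open Polynomials ℝ
  open IntegerSolver commutativeRing
  open OrderedField ℝ
  open RealPolynomials ℝ
  open SetoidReasoning setoid

  open GroupProperties +-group using () renaming (x∙y⁻¹≈ε⇒x≈y to x-y≈0⇒x≈y)

  -- Inter b f g says f ≪ g with all zeros at most b: the zeros of f and g merge
  -- into one decreasing list alternating between g and f, which begins with the
  -- largest zero a of g.
  data Inter (b : Carrier) (f g : Poly) : Set where
    constants : ∀ c d → 0# < c → 0# < d → f ≈ₚ C c → g ≈ₚ C d → Inter b f g
    cons      : ∀ a g′ → a ≤ b → g ≈ₚ [X- a ] g′ → Inter a g′ f → Inter b f g

  Inter-cong : ∀ {b f f′ g g′} → f ≈ₚ f′ → g ≈ₚ g′ → Inter b f g → Inter b f′ g′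
  Inter-cong f≈ g≈ (constants c d 0<c 0<d f≈c g≈d) =
    constants c d 0<c 0<d (λ k → trans (sym (f≈ k)) (f≈c k)) (λ k → trans (sym (g≈ k)) (g≈d k))
  Inter-cong f≈ g≈ (cons a g′ a≤b eq I) =
    cons a g′ a≤b (λ k → trans (sym (g≈ k)) (eq k)) (Inter-cong (λ _ → refl) f≈ I)

  Inter-weaken : ∀ {b c f g} → b ≤ c → Inter b f g → Inter c f g
  Inter-weaken b≤c (constants c d 0<c 0<d f≈ g≈) = constants c d 0<c 0<d f≈ g≈
  Inter-weaken b≤c (cons a g′ a≤b eq I)          = cons a g′ (≤-trans a≤b b≤c) eq I

  constant-value : ∀ {f} c → f ≈ₚ C c → ∀ t → eval f t ≈ c
  constant-value {f} c f≈c t = trans (eval-congˡ {f} {C c} f≈c t) (eval-C c t)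

  constant-pos : ∀ {f c} → 0# < c → f ≈ₚ C c → ∀ t → 0# < eval f t
  constant-pos {f} {c} 0<c f≈c t = <-respʳ (sym (constant-value {f} c f≈c t)) 0<c

  [X-]-zero : ∀ {f} a q → f ≈ₚ [X- a ] q → ∀ {t} → t ≈ a → eval f t ≈ 0#
  [X-]-zero {f} a q f≈ {t} t≈a = begin
    eval f t           ≈⟨ eval-≈[X-] {f} a q f≈ t ⟩
    (t - a) * eval q t ≈⟨ *-congʳ (trans (+-congʳ t≈a) (-‿inverseʳ a)) ⟩
    0# * eval q t      ≈⟨ zeroˡ _ ⟩
    0#                 ∎

  [X-]-other-zero : ∀ {f} a q → f ≈ₚ [X- a ] q →
    ∀ {t} → ¬ t ≈ a → eval f t ≈ 0# → eval q t ≈ 0#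
  [X-]-other-zero {f} a q f≈ {t} t≉a ft≈0 = no-zero-divisors {t - a} {eval q t}
    (λ t-a≈0 → t≉a (x-y≈0⇒x≈y t a t-a≈0))
    (trans (sym (eval-≈[X-] {f} a q f≈ t)) ft≈0)

  constant-no-zero : ∀ {f c} {A : Set} → 0# < c → f ≈ₚ C c → ∀ {t} → eval f t ≈ 0# → A
  constant-no-zero {f} 0<c f≈c {t} ft≈0 = ⊥-elim (<-irrefl (sym ft≈0) (constant-pos {f} 0<c f≈c t))

  [X-]-pos : ∀ {f} a q → f ≈ₚ [X- a ] q → ∀ {t} → a < t → 0# < eval q t → 0# < eval f t
  [X-]-pos {f} a q f≈ {t} a<t 0<qt =
    <-respʳ (sym (eval-≈[X-] {f} a q f≈ t)) (*-pos (x<y⇒0<y-x a<t) 0<qt)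

  Inter-pos : ∀ {b f g t} → Inter b f g → b < t → 0# < eval f t × 0# < eval g t
  Inter-pos {f = f} {g} {t} (constants c d 0<c 0<d f≈ g≈) _ =
    constant-pos {f} 0<c f≈ t , constant-pos {g} 0<d g≈ t
  Inter-pos {f = f} {g} {t} (cons a g′ a≤b eq I) b<t with Inter-pos I (≤-<-trans a≤b b<t)
  ... | 0<g′t , 0<ft = 0<ft , [X-]-pos {g} a g′ eq (≤-<-trans a≤b b<t) 0<g′t

  Inter-nonneg : ∀ {b f g t} → Inter b f g → b ≤ t → 0# ≤ eval f t × 0# ≤ eval g t
  Inter-nonneg {f = f} {g} {t} (constants c d 0<c 0<d f≈ g≈) _ =
    inj₁ (constant-pos {f} 0<c f≈ t) , inj₁ (constant-pos {g} 0<d g≈ t)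
  Inter-nonneg {f = f} {g} {t} (cons a g′ a≤b eq I) b≤t with Inter-nonneg I (≤-trans a≤b b≤t)
  ... | 0≤g′t , 0≤ft = 0≤ft , ≤-respʳ (sym (eval-≈[X-] {g} a g′ eq t))
    (*-nonneg (x≤y⇒0≤y-x (≤-trans a≤b b≤t)) 0≤g′t)

  zero-≤-bound : ∀ {b f g z} → Inter b f g → eval f z ≈ 0# → z ≤ b
  zero-≤-bound I fz≈0 = ≮⇒≥ λ b<z → <-irrefl (sym fz≈0) (proj₁ (Inter-pos I b<z))

  -- `Inter b f f` expresses that f alone is real-rooted with zeros at most b: each zero occurs
  -- twice in the merged list. Doubling the entries of one polynomial and dropping those of the
  -- other gives both claims.
  Inter-refl : ∀ {b f g} → Inter b f g → Inter b f f × Inter b g g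
  Inter-refl (constants c d 0<c 0<d f≈ g≈) =
    constants c c 0<c 0<c f≈ f≈ , constants d d 0<d 0<d g≈ g≈
  Inter-refl (cons a g′ a≤b eq I) with Inter-refl I
  ... | Ig′g′ , Iff = Inter-weaken a≤b Iff , cons a g′ a≤b eq (cons a g′ ≤-refl eq Ig′g′)

  Inter-rotate : ∀ {f g} → Inter 0# f g → Inter 0# g ([X- 0# ] f)
  Inter-rotate {f} I = cons 0# f ≤-refl (λ _ → refl) I

  -- The head of the merged list for g and x f must be 0: were it negative, x f would be positive at
  -- 0, where it vanishes. Removing that head undoes `Inter-rotate`.
  Inter-unrotate : ∀ {f g} → Inter 0# g ([X- 0# ] f) → Inter 0# f g
  Inter-unrotate {f} (constants c d 0<c 0<d g≈ Xf≈) =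
    constant-no-zero {[X- 0# ] f} 0<d Xf≈ ([X-]-zero {[X- 0# ] f} 0# f (λ _ → refl) refl)
  Inter-unrotate {f} {g} (cons a g′ a≤0 eq I) with ≤-<-total 0# a
  ... | inj₁ 0≤a = Inter-cong g′≈f (λ _ → refl) (Inter-weaken a≤0 I)
    where
    a≈0 = ≤-antisym a≤0 0≤a
    g′≈f : g′ ≈ₚ f
    g′≈f = [X-]-cancel 0# g′ f λ k →
      trans ([X-]-congᵃ g′ (sym a≈0) k) (sym (eq k))
  ... | inj₂ a<0 = ⊥-elim (<-irrefl
    (sym ([X-]-zero {[X- 0# ] f} 0# f (λ _ → refl) refl))
    ([X-]-pos {[X- 0# ] f} a g′ eq a<0 (proj₁ (Inter-pos I a<0))))

  -- Two adjacent entries z, one for each polynomial, are inserted where the merged list falls to z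
  -- or below. Being an even number of entries, they leave the alternation intact.
  Inter-insert : ∀ {b f g} z → z ≤ b → Inter b f g → Inter b ([X- z ] f) ([X- z ] g)
  Inter-insert {f = f} {g} z z≤b (constants c d 0<c 0<d f≈ g≈) =
    cons z g z≤b (λ _ → refl) (cons z f ≤-refl (λ _ → refl) (constants c d 0<c 0<d f≈ g≈))
  Inter-insert {f = f} {g} z z≤b (cons a g′ a≤b eq I) with ≤-<-total a z
  ... | inj₁ a≤z =
    cons z g z≤b (λ _ → refl) (cons z f ≤-refl (λ _ → refl) (cons a g′ a≤z eq I))
  ... | inj₂ z<a = cons a ([X- z ] g′) a≤b
    (λ k → trans ([X-]-cong z {g} {[X- a ] g′} eq k) ([X-]-comm z a g′ k))
    (Inter-insert z (inj₁ z<a) I)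

  -- At the first entry equal to z, the next one is also z: it belongs to the other polynomial,
  -- which vanishes at z and would be positive there if all its remaining zeros were smaller. Both
  -- entries are deleted together. An earlier entry differs from z, so z remains a zero of the
  -- quotient.
  Inter-divide : ∀ {b f g} z → eval f z ≈ 0# → eval g z ≈ 0# → Inter b f g →
    ∃[ f′ ] ∃[ g′ ] f ≈ₚ [X- z ] f′ × g ≈ₚ [X- z ] g′ × Inter b f′ g′
  Inter-divide {f = f} z fz≈0 gz≈0 (constants c d 0<c 0<d f≈ g≈) =
    constant-no-zero {f} 0<c f≈ fz≈0
  Inter-divide {b} {f} {g} z fz≈0 gz≈0 (cons a g′ a≤b g≈ I) = by-cases (z ≟ a) I
    where
    Goal : Set
    Goal = ∃[ f′ ] ∃[ g′ ] f ≈ₚ [X- z ] f′ × g ≈ₚ [X- z ] g′ × Inter b f′ g′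

    extend : (∃[ g″ ] ∃[ f′ ] g′ ≈ₚ [X- z ] g″ × f ≈ₚ [X- z ] f′ × Inter a g″ f′) → Goal
    extend (g″ , f′ , g′≈ , f≈ , J) = f′ , [X- a ] g″ , f≈ ,
      (λ k → trans (g≈ k) (trans ([X-]-cong a {g′} {[X- z ] g″} g′≈ k) ([X-]-comm a z g″ k))) ,
      cons a g″ a≤b (λ _ → refl) J

    by-cases : Dec (z ≈ a) → Inter a g′ f → Goal
    by-cases (no z≉a)  I = extend (Inter-divide z ([X-]-other-zero {g} a g′ g≈ z≉a gz≈0) fz≈0 I)
    by-cases (yes z≈a) (constants c d 0<c 0<d g′≈ f≈) = constant-no-zero {f} 0<d f≈ fz≈0
    by-cases (yes z≈a) (cons c f′ c≤a f≈ J) = f′ , g′ ,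
      (λ k → trans (f≈ k) ([X-]-congᵃ f′ c≈z k)) ,
      (λ k → trans (g≈ k) ([X-]-congᵃ g′ (sym z≈a) k)) ,
      Inter-weaken (≤-trans c≤a a≤b) J
      where
      c≈z : c ≈ z
      c≈z = ≤-antisym (≤-respʳ (sym z≈a) c≤a)
        (≮⇒≥ λ c<z → <-irrefl (sym fz≈0) ([X-]-pos {f} c f′ f≈ c<z (proj₁ (Inter-pos J c<z))))

  -- Zero lists of a single polynomial and signs at the zeros.

  data Zeros (b : Carrier) (f : Poly) : List Carrier → Set where
    noZero  : ∀ c → 0# < c → f ≈ₚ C c → Zeros b f []
    addZero : ∀ {us} u f′ → u ≤ b → f ≈ₚ [X- u ] f′ → Zeros u f′ us → Zeros b f (u ∷ us)

  Zeros-weaken : ∀ {b c f us} → b ≤ c → Zeros b f us → Zeros c f us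
  Zeros-weaken b≤c (noZero d 0<d f≈)    = noZero d 0<d f≈
  Zeros-weaken b≤c (addZero u f′ u≤b f≈ Zf′) = addZero u f′ (≤-trans u≤b b≤c) f≈ Zf′

  Inter⇒Zeros : ∀ {b f g} → Inter b f g → ∃ (Zeros b f) × ∃ (Zeros b g)
  Inter⇒Zeros (constants c d 0<c 0<d f≈ g≈) = (_ , noZero c 0<c f≈) , (_ , noZero d 0<d g≈)
  Inter⇒Zeros (cons a g′ a≤b eq I) with Inter⇒Zeros I
  ... | (_ , Zg′) , (_ , Zf) = (_ , Zeros-weaken a≤b Zf) , (_ , addZero a g′ a≤b eq Zg′)

  Zeros-pos : ∀ {b f us t} → Zeros b f us → b < t → 0# < eval f t
  Zeros-pos {f = f} {t = t} (noZero c 0<c f≈) _   = constant-pos {f} 0<c f≈ t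
  Zeros-pos {f = f} (addZero u f′ u≤b f≈ Zf′)      b<t =
    [X-]-pos {f} u f′ f≈ (≤-<-trans u≤b b<t) (Zeros-pos Zf′ (≤-<-trans u≤b b<t))

  Zeros-divide : ∀ {b f us} z → Zeros b f us → eval f z ≈ 0# →
    ∃[ f′ ] ∃[ us′ ] f ≈ₚ [X- z ] f′ × Zeros b f′ us′ × length us ≡ suc (length us′)
  Zeros-divide {f = f} z (noZero c 0<c f≈) fz≈0 = constant-no-zero {f} 0<c f≈ fz≈0
  Zeros-divide {b} {f} z (addZero {us} u f′ u≤b f≈ Zf′) fz≈0 = by-cases (z ≟ u)
    where
    Goal : Set
    Goal = ∃[ f′ ] ∃[ us′ ]
      f ≈ₚ [X- z ] f′ × Zeros b f′ us′ × suc (length us) ≡ suc (length us′)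

    extend : (∃[ f″ ] ∃[ us′ ]
      f′ ≈ₚ [X- z ] f″ × Zeros u f″ us′ × length us ≡ suc (length us′)) → Goal
    extend (f″ , us′ , f′≈ , Zf″ , len) = [X- u ] f″ , u ∷ us′ ,
      (λ k → trans (f≈ k) (trans ([X-]-cong u {f′} {[X- z ] f″} f′≈ k) ([X-]-comm u z f″ k))) ,
      addZero u f″ u≤b (λ _ → refl) Zf″ , ≡.cong suc len

    by-cases : Dec (z ≈ u) → Goal
    by-cases (yes z≈u) = f′ , us , (λ k → trans (f≈ k) ([X-]-congᵃ f′ (sym z≈u) k)) ,
      Zeros-weaken u≤b Zf′ , ≡.refl
    by-cases (no z≉u)  = extend (Zeros-divide z Zf′ ([X-]-other-zero {f} u f′ f≈ z≉u fz≈0))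

  -- Signs of φ at the zeros u₁ ≥ u₂ ≥ …, namely (-1)ⁱ φ(uᵢ) ≥ 0 or > 0.

  Alternating : (Carrier → Carrier) → List Carrier → Set
  Alternating φ []       = ⊤
  Alternating φ (u ∷ us) = φ u ≤ 0# × Alternating (λ t → - φ t) us

  StrictlyAlternating : (Carrier → Carrier) → List Carrier → Set
  StrictlyAlternating φ []       = ⊤
  StrictlyAlternating φ (u ∷ us) = φ u < 0# × StrictlyAlternating (λ t → - φ t) us

  private
    negate-product : ∀ {x y z} → x ≈ y * z → - x ≈ y * - z
    negate-product {y = y} {z} x≈yz = trans (-‿cong x≈yz)
      (solve 2 (λ y z → :- (y :* z) := y :* :- z) refl y z)

  -- Meant for the weight a - t, which is nonnegative at zeros up to a: it passes from a quotient g′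
  -- to -g = (a - t) g′. `StrictlyAlternating-unscale` goes the opposite way when a zero a has been
  -- divided out.
  Alternating-scale : ∀ {b f us} (φ ψ w : Carrier → Carrier) → Zeros b f us →
    (∀ t → t ≤ b → 0# ≤ w t) → (∀ t → ψ t ≈ w t * φ t) →
    Alternating φ us → Alternating ψ us
  Alternating-scale φ ψ w (noZero _ _ _)       0≤w ψ≈ _           = tt
  Alternating-scale φ ψ w (addZero u f′ u≤b _ Zf′) 0≤w ψ≈ (φu≤0 , alt) =
    0≤d⇒x≤y (*-nonneg (0≤w u u≤b) (x≤0⇒0≤-x φu≤0))
      (trans (sym (negate-product (ψ≈ u))) (sym (+-identityˡ _))) ,
    Alternating-scale (λ t → - φ t) (λ t → - ψ t) w Zf′ (λ t t≤u → 0≤w t (≤-trans t≤u u≤b))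
      (λ t → negate-product (ψ≈ t)) alt

  StrictlyAlternating-unscale : ∀ {b f us} (φ ψ w : Carrier → Carrier) → Zeros b f us →
    (∀ t → t ≤ b → 0# < w t) → (∀ t → ψ t ≈ w t * φ t) →
    StrictlyAlternating ψ us → StrictlyAlternating φ us
  StrictlyAlternating-unscale φ ψ w (noZero _ _ _)       0<w ψ≈ _           = tt
  StrictlyAlternating-unscale φ ψ w (addZero u f′ u≤b _ Zf′) 0<w ψ≈ (ψu<0 , alt) =
    0<d⇒x<y (pos-factorʳ (0<w u u≤b)
      (<-respʳ (negate-product (ψ≈ u)) (x<0⇒0<-x ψu<0))) (sym (+-identityˡ _)) ,
    StrictlyAlternating-unscale (λ t → - φ t) (λ t → - ψ t) w Zf′
      (λ t t≤u → 0<w t (≤-trans t≤u u≤b)) (λ t → negate-product (ψ≈ t)) alt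

  -- Nonnegative instead of positive makes the condition closed under sums and allows a degree below
  -- n. The sign of a leading coefficient in lower degree is then left open; where it matters, it
  -- comes from positivity at a point.
  Degree≤ : ℕ → Poly → Set
  Degree≤ n p = 0# ≤ coeff p n × (∀ k → n ℕ.< k → coeff p k ≈ 0#)

  Degree≤-[X-] : ∀ {n p} a q → p ≈ₚ [X- a ] q → Degree≤ n q → Degree≤ (suc n) p
  Degree≤-[X-] {n} {p} a q p≈ (0≤qn , vanish) =
    ≤-respʳ (sym (lower n ℕ.≤-refl)) 0≤qn ,
    λ { (suc k) (s≤s n<k) → trans (lower k (ℕ.<⇒≤ n<k)) (vanish k n<k) }
    where
    lower : ∀ k → n ℕ.≤ k → coeff p (suc k) ≈ coeff q k
    lower k n≤k = begin
      coeff p (suc k)                    ≈⟨ trans (p≈ (suc k)) (coeff-[X-]-suc a q k) ⟩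
      coeff q k - a * coeff q (suc k)    ≈⟨ +-congˡ (-‿cong (*-congˡ (vanish (suc k) (s≤s n≤k)))) ⟩
      coeff q k - a * 0#                 ≈⟨ solve 2 (λ c a → c :- a :* con (+ 0) := c) refl _ a ⟩
      coeff q k                          ∎

  Degree≤-quotient : ∀ {n p} a q → p ≈ₚ [X- a ] q → Degree≤ (suc n) p → Degree≤ n q
  Degree≤-quotient {n} {p} a q p≈ (0≤p , vanish) =
    ≤-respʳ (begin
      coeff p (suc n)                    ≈⟨ trans (p≈ (suc n)) (coeff-[X-]-suc a q n) ⟩
      coeff q n - a * coeff q (suc n)    ≈⟨ +-congˡ (-‿cong (*-congˡ (q-vanish (suc n) ℕ.≤-refl))) ⟩
      coeff q n - a * 0#                 ≈⟨ solve 2 (λ c a → c :- a :* con (+ 0) := c) refl _ a ⟩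
      coeff q n                          ∎) 0≤p ,
    q-vanish
    where
    q-vanish : ∀ k → n ℕ.< k → coeff q k ≈ 0#
    q-vanish = [X-]-cancel-from a q 0ₚ (suc n) λ k n<k → begin
      coeff ([X- a ] q) (suc k)    ≈⟨ p≈ (suc k) ⟨
      coeff p (suc k)              ≈⟨ vanish (suc k) (s≤s n<k) ⟩
      0#                           ≈⟨ solve 1 (λ a → con (+ 0) := con (+ 0) :- a :* con (+ 0)) refl a ⟩
      0# - a * 0#                  ≈⟨ coeff-[X-]-suc a 0ₚ k ⟨
      coeff ([X- a ] 0ₚ) (suc k)   ∎

  Degree≤-+ : ∀ {n p q} → Degree≤ n p → Degree≤ n q → Degree≤ n (p +ₚ q)
  Degree≤-+ {n} {p} {q} (0≤p , p-vanish) (0≤q , q-vanish) =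
    ≤-respʳ (sym (coeff-+ p q n)) (+-nonneg 0≤p 0≤q) ,
    λ k n<k → trans (coeff-+ p q k)
      (trans (+-cong (p-vanish k n<k) (q-vanish k n<k)) (+-identityˡ 0#))

  Degree≤-constant : ∀ f c → 0# < c → f ≈ₚ C c → Degree≤ 0 f
  Degree≤-constant f c 0<c f≈ = ≤-respʳ (sym (f≈ 0)) (inj₁ 0<c) , λ { (suc k) _ → f≈ (suc k) }

  Degree≤-suc : ∀ n f → Degree≤ n f → Degree≤ (suc n) f
  Degree≤-suc n f (_ , vanish) = inj₂ (sym (vanish (suc n) ℕ.≤-refl)) ,
    λ k n<k → vanish k (ℕ.<-trans (ℕ.n<1+n n) n<k)

  -- Between two consecutive zeros of f lies one zero of g, so each zero of f has one more zero of g
  -- above it than the previous one had. Two layers of `Inter` are removed per zero of f. The zeros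
  -- of f are listed twice, by `Inter` and by `Zeros`; `f₁` keeps track of the second factorisation.
  Inter⇒Alternating : ∀ {b b′ f f₁ g us} → Inter b f g → f ≈ₚ f₁ → Zeros b′ f₁ us →
    Alternating (eval g) us × Degree≤ (suc (length us)) g
  Inter⇒Alternating {g = g} (constants c d 0<c 0<d f≈ g≈) f≈f₁ (noZero _ _ _) =
    tt , Degree≤-suc 0 g (Degree≤-constant g d 0<d g≈)
  Inter⇒Alternating {f = f} (constants c d 0<c 0<d f≈ g≈) f≈f₁ (addZero u f′ u≤b f₁≈ _) =
    constant-no-zero {f} 0<c f≈ ([X-]-zero {f} u f′ (λ k → trans (f≈f₁ k) (f₁≈ k)) refl)
  Inter⇒Alternating {g = g} (cons a g′ a≤b g≈ (constants c d 0<c 0<d g′≈ f≈)) f≈f₁ (noZero _ _ _) =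
    tt , Degree≤-[X-] {p = g} a g′ g≈ (Degree≤-constant g′ c 0<c g′≈)
  Inter⇒Alternating {f = f} (cons a g′ a≤b g≈ (constants c d 0<c 0<d g′≈ f≈)) f≈f₁
                    (addZero u f′ u≤b f₁≈ _) =
    constant-no-zero {f} 0<d f≈ ([X-]-zero {f} u f′ (λ k → trans (f≈f₁ k) (f₁≈ k)) refl)
  Inter⇒Alternating {f₁ = f₁} (cons a g′ a≤b g≈ (cons c f′ c≤a f≈ I)) f≈f₁ (noZero d 0<d f₁≈) =
    constant-no-zero {f₁} 0<d f₁≈ ([X-]-zero {f₁} c f′ (λ k → trans (sym (f≈f₁ k)) (f≈ k)) refl)
  Inter⇒Alternating {f = f} {f₁} {g} (cons a g′ a≤b g≈ (cons c f′ c≤a f≈ I)) f≈f₁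
                    (addZero u f₁′ u≤b f₁≈ Zf₁′) =
    (g-nonpos , Alternating-scale (eval g′) (λ t → - eval g t) (λ t → a - t) Zf₁′
       (λ t t≤u → x≤y⇒0≤y-x (≤-trans t≤u u≤a)) -g≈ (proj₁ rest)) ,
    Degree≤-[X-] {p = g} a g′ g≈ (proj₂ rest)
    where
    -- Both are the largest zero of f: at the larger of two different values, the factorisation with
    -- the smaller head would be positive.
    c≈u : c ≈ u
    c≈u = ≤-antisym
      (≮⇒≥ λ u<c → <-irrefl (sym ([X-]-zero {f₁} c f′ (λ k → trans (sym (f≈f₁ k)) (f≈ k)) refl))
        ([X-]-pos {f₁} u f₁′ f₁≈ u<c (Zeros-pos Zf₁′ u<c)))
      (≮⇒≥ λ c<u → <-irrefl (sym ([X-]-zero {f} u f₁′ (λ k → trans (f≈f₁ k) (f₁≈ k)) refl))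
        ([X-]-pos {f} c f′ f≈ c<u (proj₁ (Inter-pos I c<u))))

    f′≈f₁′ : f′ ≈ₚ f₁′
    f′≈f₁′ = [X-]-cancel c f′ f₁′ λ k → trans (sym (f≈ k))
      (trans (trans (f≈f₁ k) (f₁≈ k)) ([X-]-congᵃ f₁′ (sym c≈u) k))

    rest = Inter⇒Alternating I f′≈f₁′ Zf₁′

    u≤a : u ≤ a
    u≤a = ≤-respˡ c≈u c≤a

    -g≈ : ∀ t → - eval g t ≈ (a - t) * eval g′ t
    -g≈ t = trans (-‿cong (eval-≈[X-] {g} a g′ g≈ t))
      (solve 3 (λ a t e → :- ((t :- a) :* e) := (a :- t) :* e) refl a t (eval g′ t))

    g-nonpos : eval g u ≤ 0#
    g-nonpos = 0≤d⇒x≤y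
      (*-nonneg (x≤y⇒0≤y-x u≤a) (proj₂ (Inter-nonneg I (inj₂ c≈u))))
      (trans (sym (-g≈ u)) (sym (+-identityˡ _)))

  -- From g(u) < 0 < g(t) the intermediate value theorem finds a zero a strictly between u and t.
  -- The quotient by X - a is positive at u and has strictly alternating signs at the remaining
  -- zeros of f, so u takes the place of t. When the zeros of f are exhausted, the degree bound
  -- leaves g constant or linear with positive slope.
  StrictlyAlternating⇒Inter : ∀ {f g us} t → Zeros t f us → 0# < eval g t →
    StrictlyAlternating (eval g) us → Degree≤ (suc (length us)) g → Inter t f g
  StrictlyAlternating⇒Inter {f} {g} t (noZero c 0<c f≈) 0<gt _ (inj₂ 0≈g₁ , vanish) =
    constants c (coeff g 0) 0<c (<-respʳ (constant-value {g} (coeff g 0) g≈ t) 0<gt) f≈ g≈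
    where
    g≈ : g ≈ₚ C (coeff g 0)
    g≈ 0             = refl
    g≈ 1             = sym 0≈g₁
    g≈ (suc (suc k)) = vanish (suc (suc k)) (s≤s (s≤s z≤n))
  StrictlyAlternating⇒Inter {f} {g} t (noZero c 0<c f≈) 0<gt _ (inj₁ 0<g₁ , vanish) =
    cons a (C g₁) a≤t g≈ (constants g₁ c 0<g₁ 0<c (λ _ → refl) f≈)
    where
    g₁ = coeff g 1
    g₁⁻¹ = proj₁ (inverse-pos 0<g₁)
    -- The zero of g₀ + g₁ x; it lies below t because g₁ (t - a) = g(t) > 0.
    a = - (coeff g 0 * g₁⁻¹)

    g≈ : g ≈ₚ [X- a ] C g₁
    g≈ 0 = sym (begin
      coeff ([X- a ] C g₁) 0           ≈⟨ coeff-[X-]-zero a (C g₁) ⟩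
      - (- (coeff g 0 * g₁⁻¹) * g₁)    ≈⟨ solve 3 (λ x y z → :- ((:- (x :* y)) :* z) := x :* (z :* y))
                                             refl (coeff g 0) g₁⁻¹ g₁ ⟩
      coeff g 0 * (g₁ * g₁⁻¹)          ≈⟨ *-congˡ (proj₂ (proj₂ (inverse-pos 0<g₁))) ⟩
      coeff g 0 * 1#                   ≈⟨ *-identityʳ _ ⟩
      coeff g 0                        ∎)
    g≈ 1 = sym (trans (coeff-[X-]-suc a (C g₁) 0)
      (solve 2 (λ c a → c :- a :* con (+ 0) := c) refl g₁ a))
    g≈ (suc (suc k)) = trans (vanish (suc (suc k)) (s≤s (s≤s z≤n)))
      (sym (trans (coeff-[X-]-suc a (C g₁) (suc k))
        (solve 1 (λ a → con (+ 0) :- a :* con (+ 0) := con (+ 0)) refl a)))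

    a≤t : a ≤ t
    a≤t = inj₁ (0<d⇒x<y (pos-factorʳ 0<g₁ (<-respʳ
      (trans (eval-≈[X-] {g} a (C g₁) g≈ t)
        (trans (*-comm _ _) (*-congʳ (eval-C g₁ t)))) 0<gt)) refl)
  StrictlyAlternating⇒Inter {f} {g} t (addZero u f′ u≤t f≈ Zf′) 0<gt (gu<0 , alt) deg =
    cons a q (inj₁ a<t) g≈ (cons u f′ (inj₁ u<a) f≈
      (StrictlyAlternating⇒Inter u Zf′
        (pos-factorʳ (x<y⇒0<y-x u<a) (<-respʳ (-g≈ u) (x<0⇒0<-x gu<0)))
        (StrictlyAlternating-unscale (eval q) (λ t → - eval g t) (λ t → a - t) Zf′
          (λ t t≤u → x<y⇒0<y-x (≤-<-trans t≤u u<a)) -g≈ alt)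
        (Degree≤-quotient {p = g} a q g≈ deg)))
    where
    u<t : u < t
    u<t = ≤∧≉⇒< u≤t λ u≈t →
      <-irrefl refl (<-trans 0<gt (<-respˡ (eval-congʳ g u≈t) gu<0))

    root = intermediate-value g u<t gu<0 0<gt
    a = proj₁ root
    u<a = proj₁ (proj₂ root)
    a<t = proj₁ (proj₂ (proj₂ root))
    q = quotient g a

    g≈ : g ≈ₚ [X- a ] q
    g≈ = factor g a (proj₂ (proj₂ (proj₂ root)))

    -g≈ : ∀ t → - eval g t ≈ (a - t) * eval q t
    -g≈ t = trans (-‿cong (eval-≈[X-] {g} a q g≈ t))
      (solve 3 (λ a t e → :- ((t :- a) :* e) := (a :- t) :* e) refl a t (eval q t))

  -- The sign count has to start at a point where g is strictly positive, hence above b; this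
  -- restores the bound b afterwards.
  Inter-tighten : ∀ {b t f g} → (∀ x → b < x → 0# < eval g x) → Inter t f g → Inter b f g
  Inter-tighten pos (constants c d 0<c 0<d f≈ g≈) = constants c d 0<c 0<d f≈ g≈
  Inter-tighten {g = g} pos (cons a g′ a≤t g≈ I) = cons a g′
    (≮⇒≥ λ b<a → <-irrefl (sym ([X-]-zero {g} a g′ g≈ refl)) (pos a b<a)) g≈ I

  -- Closure of interlacing under sums.

  nonpos-sum-zero : ∀ {x y} → x ≤ 0# → y ≤ 0# → ¬ (x + y < 0#) → x ≈ 0# × y ≈ 0#
  nonpos-sum-zero {x} {y} x≤0 y≤0 x+y≮0 =
    ≤-antisym x≤0 (≮⇒≥ λ x<0 → x+y≮0 (<-≤-trans (+-monoˡ-< y x<0)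
      (≤-respˡ (sym (+-identityˡ y)) y≤0))) ,
    ≤-antisym y≤0 (≮⇒≥ λ y<0 → x+y≮0 (<-respˡ (+-comm y x) (<-≤-trans (+-monoˡ-< x y<0)
      (≤-respˡ (sym (+-identityˡ x)) x≤0))))

  -- Two numbers of the same weak sign add up to one of strict sign unless both are zero. The first
  -- zero of f where strictness fails is therefore common to all three polynomials.
  Alternating-sum : ∀ {b f us} (φ ψ χ : Carrier → Carrier) → (∀ t → χ t ≈ φ t + ψ t) →
    Zeros b f us → Alternating φ us → Alternating ψ us →
    (∃[ z ] eval f z ≈ 0# × φ z ≈ 0# × ψ z ≈ 0#) ⊎ StrictlyAlternating χ us
  Alternating-sum φ ψ χ χ≈ (noZero _ _ _) _ _ = inj₂ tt
  Alternating-sum {f = f} φ ψ χ χ≈ (addZero u f′ u≤b f≈ Zf′) (φu≤0 , φ-alt) (ψu≤0 , ψ-alt)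
    with ≤-<-total 0# (χ u)
  ... | inj₁ 0≤χu = inj₁ (u , [X-]-zero {f} u f′ f≈ refl ,
    nonpos-sum-zero φu≤0 ψu≤0 λ sum<0 → <⇒≱ (<-respˡ (sym (χ≈ u)) sum<0) 0≤χu)
  ... | inj₂ χu<0 with Alternating-sum (λ t → - φ t) (λ t → - ψ t) (λ t → - χ t)
    (λ t → trans (-‿cong (χ≈ t)) (solve 2 (λ x y → :- (x :+ y) := :- x :+ :- y) refl (φ t) (ψ t)))
    Zf′ φ-alt ψ-alt
  ... | inj₂ alt = inj₂ (χu<0 , alt)
  ... | inj₁ (z , f′z≈0 , -φz≈0 , -ψz≈0) = inj₁ (z ,
    trans (eval-≈[X-] {f} u f′ f≈ z) (trans (*-congˡ f′z≈0) (zeroʳ _)) ,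
    unneg -φz≈0 , unneg -ψz≈0)
    where
    unneg : ∀ {x} → - x ≈ 0# → x ≈ 0#
    unneg {x} -x≈0 = trans (solve 1 (λ x → x := :- :- x) refl x) (trans (-‿cong -x≈0) -0#≈0#)

  -- A common zero of f, g₁ and g₂ is divided out; without one, g₁ + g₂ strictly
  -- changes sign between consecutive zeros of f, which are then simple.
  Inter-+ʳ : ∀ {b f g₁ g₂} → Inter b f g₁ → Inter b f g₂ → Inter b f (g₁ +ₚ g₂)
  Inter-+ʳ {b} I₁ I₂ = by-degree _ (proj₂ (proj₁ (Inter⇒Zeros I₁))) ≡.refl I₁ I₂
    where
    by-degree : ∀ n {f g₁ g₂ us} → Zeros b f us → length us ≡ n →
      Inter b f g₁ → Inter b f g₂ → Inter b f (g₁ +ₚ g₂)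
    by-degree n {f} {g₁} {g₂} {us} Zf len I₁ I₂
      with Inter⇒Alternating I₁ (λ _ → refl) Zf | Inter⇒Alternating I₂ (λ _ → refl) Zf
    ... | alt₁ , deg₁ | alt₂ , deg₂
      with Alternating-sum (eval g₁) (eval g₂) (eval (g₁ +ₚ g₂)) (eval-+ g₁ g₂) Zf alt₁ alt₂
    -- At b itself the sum may vanish, so the count starts at b + 1, an arbitrary point above b.
    ... | inj₂ alt = Inter-tighten {g = g₁ +ₚ g₂} pos
      (StrictlyAlternating⇒Inter {g = g₁ +ₚ g₂} (b + 1#) (Zeros-weaken (inj₁ b<b+1) Zf)
        (pos (b + 1#) b<b+1) alt (Degree≤-+ {p = g₁} {g₂} deg₁ deg₂))
      where
      b<b+1 : b < b + 1#
      b<b+1 = 0<d⇒x<y 0<1 (solve 2 (λ b x → x := (b :+ x) :- b) refl b 1#)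

      pos : ∀ x → b < x → 0# < eval (g₁ +ₚ g₂) x
      pos x b<x = <-respʳ (sym (eval-+ g₁ g₂ x))
        (+-pos-nonneg (proj₂ (Inter-pos I₁ b<x)) (inj₁ (proj₂ (Inter-pos I₂ b<x))))
    ... | inj₁ (z , fz≈0 , g₁z≈0 , g₂z≈0)
      with Zeros-divide z Zf fz≈0 | Inter-divide z fz≈0 g₁z≈0 I₁ | Inter-divide z fz≈0 g₂z≈0 I₂
    by-degree zero {f} {g₁} {g₂} Zf len I₁ I₂ | _ | _
      | inj₁ (z , fz≈0 , g₁z≈0 , g₂z≈0) | _ , _ , _ , _ , len′ | _ | _ with ≡.trans (≡.sym len) len′
    ... | ()
    by-degree (suc n) {f} {g₁} {g₂} Zf len I₁ I₂ | _ | _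
      | inj₁ (z , fz≈0 , g₁z≈0 , g₂z≈0)
      | f′ , us′ , f≈ , Zf′ , len′ | f₁ , h₁ , f≈₁ , g₁≈ , J₁ | f₂ , h₂ , f≈₂ , g₂≈ , J₂ =
      Inter-cong (≈ₚ-sym {f} {[X- z ] f′} f≈) sum≈
        (Inter-insert {f = f′} {h₁ +ₚ h₂} z (zero-≤-bound I₁ fz≈0)
          (by-degree n {f′} {h₁} {h₂} Zf′ (ℕ.suc-injective (≡.trans (≡.sym len′) len))
            (Inter-cong (same f₁ f≈₁) (λ _ → refl) J₁)
            (Inter-cong (same f₂ f≈₂) (λ _ → refl) J₂)))
      where
      -- Each of the three divisions by X - z returns its own cofactor of f; cancelling X - z
      -- identifies them.
      same : ∀ p → f ≈ₚ [X- z ] p → p ≈ₚ f′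
      same p f≈p = [X-]-cancel z p f′ λ k → trans (sym (f≈p k)) (f≈ k)

      sum≈ : [X- z ] (h₁ +ₚ h₂) ≈ₚ g₁ +ₚ g₂
      sum≈ k = begin
        coeff ([X- z ] (h₁ +ₚ h₂)) k                     ≈⟨ [X-]-distrib-+ z h₁ h₂ k ⟩
        coeff ([X- z ] h₁ +ₚ [X- z ] h₂) k               ≈⟨ coeff-+ ([X- z ] h₁) ([X- z ] h₂) k ⟩
        coeff ([X- z ] h₁) k + coeff ([X- z ] h₂) k      ≈⟨ +-cong (g₁≈ k) (g₂≈ k) ⟨
        coeff g₁ k + coeff g₂ k                          ≈⟨ coeff-+ g₁ g₂ k ⟨
        coeff (g₁ +ₚ g₂) k                               ∎

-- Interlacing of possibly zero polynomials.

module InterlacingSequences (ℝ : CompleteOrderedField) where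
  open CompleteOrderedField ℝ hiding (zero)
  open Polynomials ℝ
  open IntegerSolver commutativeRing
  open OrderedField ℝ
  open RealPolynomials ℝ
  open InterlacingPairs ℝ
  open SetoidReasoning setoid

  infix 4 _⊑_
  -- The bound 0 is what rotation needs. If a polynomial is zero, nothing is said about the other
  -- one; its real-rootedness must come from a separate comparison with itself.
  _⊑_ : Poly → Poly → Set
  f ⊑ g = f ≈ₚ 0ₚ ⊎ g ≈ₚ 0ₚ ⊎ Inter 0# f g

  ⊑-cong : ∀ {f f′ g g′} → f ≈ₚ f′ → g ≈ₚ g′ → f ⊑ g → f′ ⊑ g′
  ⊑-cong f≈ g≈ (inj₁ f≈0)        = inj₁ λ k → trans (sym (f≈ k)) (f≈0 k)
  ⊑-cong f≈ g≈ (inj₂ (inj₁ g≈0)) = inj₂ (inj₁ λ k → trans (sym (g≈ k)) (g≈0 k))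
  ⊑-cong f≈ g≈ (inj₂ (inj₂ I))   = inj₂ (inj₂ (Inter-cong f≈ g≈ I))

  [X-0]≈shift : ∀ f → [X- 0# ] f ≈ₚ 0# ∷ f
  [X-0]≈shift f zero    = trans (coeff-[X-]-zero 0# f)
    (solve 1 (λ c → :- (con (+ 0) :* c) := con (+ 0)) refl (coeff f 0))
  [X-0]≈shift f (suc k) = trans (coeff-[X-]-suc 0# f k)
    (solve 2 (λ c d → c :- con (+ 0) :* d := c) refl (coeff f k) (coeff f (suc k)))

  shift-cong : ∀ {f g} → f ≈ₚ g → 0# ∷ f ≈ₚ 0# ∷ g
  shift-cong f≈g zero    = refl
  shift-cong f≈g (suc k) = f≈g k

  ⊑-rotate : ∀ {f g} → f ⊑ g → g ⊑ 0# ∷ f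
  ⊑-rotate {f} (inj₁ f≈0)    = inj₂ (inj₁ λ { zero → refl ; (suc k) → f≈0 k })
  ⊑-rotate (inj₂ (inj₁ g≈0)) = inj₁ g≈0
  ⊑-rotate {f} (inj₂ (inj₂ I)) =
    inj₂ (inj₂ (Inter-cong (λ _ → refl) ([X-0]≈shift f) (Inter-rotate I)))

  ⊑-unrotate : ∀ {f g} → g ⊑ 0# ∷ f → f ⊑ g
  ⊑-unrotate (inj₁ g≈0)         = inj₂ (inj₁ g≈0)
  ⊑-unrotate (inj₂ (inj₁ Xf≈0)) = inj₁ λ k → Xf≈0 (suc k)
  ⊑-unrotate {f} (inj₂ (inj₂ I)) =
    inj₂ (inj₂ (Inter-unrotate (Inter-cong (λ _ → refl) (λ k → sym ([X-0]≈shift f k)) I)))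

  0+ₚ : ∀ f g → f ≈ₚ 0ₚ → f +ₚ g ≈ₚ g
  0+ₚ f g f≈0 k = trans (coeff-+ f g k) (trans (+-congʳ (f≈0 k)) (+-identityˡ _))

  +ₚ0 : ∀ f g → g ≈ₚ 0ₚ → f +ₚ g ≈ₚ f
  +ₚ0 f g g≈0 k = trans (coeff-+ f g k) (trans (+-congˡ (g≈0 k)) (+-identityʳ _))

  ⊑-+ʳ : ∀ {f g h} → f ⊑ g → f ⊑ h → f ⊑ g +ₚ h
  ⊑-+ʳ (inj₁ f≈0) _ = inj₁ f≈0
  ⊑-+ʳ {f} {g} {h} (inj₂ (inj₁ g≈0)) f⊑h =
    ⊑-cong (λ _ → refl) (≈ₚ-sym {g +ₚ h} {h} (0+ₚ g h g≈0)) f⊑h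
  ⊑-+ʳ (inj₂ (inj₂ I)) (inj₁ f≈0) = inj₁ f≈0
  ⊑-+ʳ {f} {g} {h} (inj₂ (inj₂ I)) (inj₂ (inj₁ h≈0)) =
    ⊑-cong (λ _ → refl) (≈ₚ-sym {g +ₚ h} {g} (+ₚ0 g h h≈0)) (inj₂ (inj₂ I))
  ⊑-+ʳ (inj₂ (inj₂ I)) (inj₂ (inj₂ J)) = inj₂ (inj₂ (Inter-+ʳ I J))

  ⊑-+ˡ : ∀ {f g h} → f ⊑ h → g ⊑ h → f +ₚ g ⊑ h
  ⊑-+ˡ {f} {g} f⊑h g⊑h = ⊑-unrotate (⊑-cong (λ _ → refl) shift-+
    (⊑-+ʳ (⊑-rotate f⊑h) (⊑-rotate g⊑h)))
    where
    shift-+ : (0# ∷ f) +ₚ (0# ∷ g) ≈ₚ 0# ∷ (f +ₚ g)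
    shift-+ zero    = +-identityˡ 0#
    shift-+ (suc k) = refl

  -- The first and third hypotheses give `f ⊑ f +ₚ g`, and each member of an interlacing pair is
  -- real-rooted. When f is zero this yields no information, and `g ⊑ g` takes over.
  ⊑-refl-+ : ∀ {f g} → f ⊑ f → g ⊑ g → f ⊑ g → f +ₚ g ⊑ f +ₚ g
  ⊑-refl-+ {f} {g} f⊑f g⊑g f⊑g = from (⊑-+ʳ f⊑f f⊑g)
    where
    from : f ⊑ f +ₚ g → f +ₚ g ⊑ f +ₚ g
    from (inj₁ f≈0)          = ⊑-cong g≈f+g g≈f+g g⊑g
      where
      g≈f+g : g ≈ₚ f +ₚ g
      g≈f+g = ≈ₚ-sym {f +ₚ g} {g} (0+ₚ f g f≈0)
    from (inj₂ (inj₁ f+g≈0)) = inj₁ f+g≈0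
    from (inj₂ (inj₂ I))     = inj₂ (inj₂ (proj₂ (Inter-refl I)))

  -- Sums of consecutive terms of a cyclic sequence.

  window : (ℕ → Poly) → ℕ → ℕ → Poly
  window F a zero    = 0ₚ
  window F a (suc k) = F a +ₚ window F (suc a) k

  -- A sequence that extends f₁, …, f_m by x f₁, …, x f_m, x² f₁, …
  record Cyclic (m : ℕ) (F : ℕ → Poly) : Set where
    field
      periodic : ∀ k → F (k ℕ.+ m) ≈ₚ 0# ∷ F k
      pairwise : ∀ {i j} → i ℕ.≤ j → j ℕ.≤ i ℕ.+ m → F i ⊑ F j

  module Windows {m F} (cyclic : Cyclic m F) where
    open Cyclic cyclic

    W : ℕ → ℕ → Poly
    W = window F

    window-++ : ∀ a k l → W a (k ℕ.+ l) ≈ₚ W a k +ₚ W (a ℕ.+ k) l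
    window-++ a zero    l t = reflexive (≡.cong (λ b → coeff (W b l) t) (≡.sym (ℕ.+-identityʳ a)))
    window-++ a (suc k) l t = begin
      coeff (F a +ₚ W (suc a) (k ℕ.+ l)) t
        ≈⟨ coeff-+ (F a) _ t ⟩
      coeff (F a) t + coeff (W (suc a) (k ℕ.+ l)) t
        ≈⟨ +-congˡ (trans (window-++ (suc a) k l t) (coeff-+ (W (suc a) k) _ t)) ⟩
      coeff (F a) t + (coeff (W (suc a) k) t + coeff (W (suc a ℕ.+ k) l) t)
        ≈⟨ +-assoc _ _ _ ⟨
      (coeff (F a) t + coeff (W (suc a) k) t) + coeff (W (suc a ℕ.+ k) l) t
        ≈⟨ +-cong (sym (coeff-+ (F a) (W (suc a) k) t))
             (reflexive (≡.cong (λ b → coeff (W b l) t) (≡.sym (ℕ.+-suc a k)))) ⟩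
      coeff (W a (suc k)) t + coeff (W (a ℕ.+ suc k) l) t
        ≈⟨ coeff-+ (W a (suc k)) _ t ⟨
      coeff (W a (suc k) +ₚ W (a ℕ.+ suc k) l) t ∎

    window-shift : ∀ a k → W (a ℕ.+ m) k ≈ₚ 0# ∷ W a k
    window-shift a zero    zero    = refl
    window-shift a zero    (suc t) = refl
    window-shift a (suc k) t = trans (coeff-+ (F (a ℕ.+ m)) (W (suc a ℕ.+ m) k) t)
      (trans (+-cong (periodic a t) (window-shift (suc a) k t)) (merge t))
      where
      merge : ∀ t → coeff (0# ∷ F a) t + coeff (0# ∷ W (suc a) k) t ≈ coeff (0# ∷ W a (suc k)) t
      merge zero    = +-identityˡ 0#
      merge (suc t) = sym (coeff-+ (F a) (W (suc a) k) t)

    term⊑window : ∀ a b l → a ℕ.≤ b → b ℕ.+ l ℕ.≤ a ℕ.+ m → F a ⊑ W b l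
    term⊑window a b zero    a≤b b≤a+m = inj₂ (inj₁ λ _ → refl)
    term⊑window a b (suc l) a≤b b+l≤a+m =
      ⊑-+ʳ (pairwise a≤b (ℕ.≤-trans (ℕ.m≤m+n b (suc l)) b+l≤a+m))
        (term⊑window a (suc b) l (ℕ.m≤n⇒m≤1+n a≤b)
          (ℕ.≤-trans (ℕ.≤-reflexive (≡.sym (ℕ.+-suc b l))) b+l≤a+m))

    window⊑window : ∀ a k b l → a ℕ.+ k ℕ.≤ b → b ℕ.+ l ℕ.≤ a ℕ.+ m → W a k ⊑ W b l
    window⊑window a zero    b l _ _ = inj₁ λ _ → refl
    window⊑window a (suc k) b l a+k≤b b+l≤a+m =
      ⊑-+ˡ (term⊑window a b l (ℕ.≤-trans (ℕ.m≤m+n a (suc k)) a+k≤b) b+l≤a+m)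
        (window⊑window (suc a) k b l (ℕ.≤-trans (ℕ.≤-reflexive (≡.sym (ℕ.+-suc a k))) a+k≤b)
          (ℕ.m≤n⇒m≤1+n b+l≤a+m))

    window⊑itself : ∀ a k → k ℕ.≤ m → W a k ⊑ W a k
    window⊑itself a zero    _   = inj₁ λ _ → refl
    window⊑itself a (suc k) k<m = ⊑-refl-+ (pairwise ℕ.≤-refl (ℕ.m≤m+n a m))
      (window⊑itself (suc a) k (ℕ.<⇒≤ k<m))
      (term⊑window a (suc a) k (ℕ.n≤1+n a)
        (ℕ.≤-trans (ℕ.≤-reflexive (≡.sym (ℕ.+-suc a k))) (ℕ.+-monoʳ-≤ a k<m)))

    -- The longer window is the shorter one plus a disjoint window after it. The shorter one is
    -- related to itself and to that remainder, and such comparisons add on the right.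
    window⊑prolongation : ∀ a k l → k ℕ.+ l ℕ.≤ m → W a k ⊑ W a (k ℕ.+ l)
    window⊑prolongation a k l k+l≤m =
      ⊑-cong (λ _ → refl) (≈ₚ-sym {W a (k ℕ.+ l)} {W a k +ₚ W (a ℕ.+ k) l} (window-++ a k l))
        (⊑-+ʳ (window⊑itself a k (ℕ.≤-trans (ℕ.m≤m+n k l) k+l≤m))
          (window⊑window a k (a ℕ.+ k) l ℕ.≤-refl
            (ℕ.≤-trans (ℕ.≤-reflexive (ℕ.+-assoc a k l)) (ℕ.+-monoʳ-≤ a k+l≤m))))

    private
      +-swapʳ : ∀ a b c → a ℕ.+ b ℕ.+ c ≡ a ℕ.+ c ℕ.+ b
      +-swapʳ a b c = ≡.trans (ℕ.+-assoc a b c)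
        (≡.trans (≡.cong (a ℕ.+_) (ℕ.+-comm b c)) (≡.sym (ℕ.+-assoc a c b)))

    -- The last hypothesis lets the second window pass i + m by at most k terms. It splits into c
    -- terms before i + m and d ≤ k terms from there on. Rotation turns the goal into a comparison
    -- with the window of length k at i + m, which the c terms precede and of which the d terms are
    -- the beginning.
    disjoint-windows : ∀ i k j l → i ℕ.+ k ℕ.≤ j → j ℕ.≤ i ℕ.+ m → j ℕ.+ l ℕ.≤ i ℕ.+ m ℕ.+ k →
      W i k ⊑ W j l
    disjoint-windows i k j l i+k≤j j≤i+m j+l≤ with j ℕ.+ l ℕ.≤? i ℕ.+ m
    ... | yes j+l≤i+m = window⊑window i k j l i+k≤j j+l≤i+m
    -- The second window reaches beyond i + m, so compare it with the first one moved to i + m.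
    ... | no  j+l≰i+m = overlapping (ℕ.m≤n⇒∃[o]m+o≡n j≤i+m)
      where
      k≤m : k ℕ.≤ m
      k≤m = ℕ.+-cancelˡ-≤ i k m (ℕ.≤-trans i+k≤j j≤i+m)

      overlapping : (∃[ c ] j ℕ.+ c ≡ i ℕ.+ m) → W i k ⊑ W j l
      overlapping (c , j+c≡i+m) = overlapping′
        (ℕ.m≤n⇒∃[o]m+o≡n (ℕ.<⇒≤ (ℕ.+-cancelˡ-< j c l
          (≡.subst (ℕ._< j ℕ.+ l) (≡.sym j+c≡i+m) (ℕ.≰⇒> j+l≰i+m)))))
        where
        overlapping″ : ∀ d → c ℕ.+ d ≡ l → (∃[ e ] d ℕ.+ e ≡ k) → W i k ⊑ W j l
        overlapping″ d ≡.refl (e , ≡.refl) = ⊑-unrotate (⊑-cong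
          (≈ₚ-sym {W j (c ℕ.+ d)} {W j c +ₚ W (j ℕ.+ c) d} (window-++ j c d))
          (λ t → trans (reflexive (≡.cong (λ a → coeff (W a k) t) j+c≡i+m)) (window-shift i k t))
          (⊑-+ˡ
            (window⊑window j c (j ℕ.+ c) k ℕ.≤-refl (ℕ.≤-trans
              (ℕ.≤-reflexive (≡.trans (≡.cong (ℕ._+ k) j+c≡i+m) (+-swapʳ i m k)))
              (ℕ.+-monoˡ-≤ m i+k≤j)))
            (window⊑prolongation (j ℕ.+ c) d e k≤m)))

        overlapping′ : (∃[ d ] c ℕ.+ d ≡ l) → W i k ⊑ W j l
        overlapping′ (d , c+d≡l) = overlapping″ d c+d≡l (ℕ.m≤n⇒∃[o]m+o≡n
          (ℕ.+-cancelˡ-≤ (i ℕ.+ m) d k (ℕ.≤-trans (ℕ.≤-reflexive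
            (≡.trans (≡.cong (ℕ._+ d) (≡.sym j+c≡i+m))
              (≡.trans (ℕ.+-assoc j c d) (≡.cong (j ℕ.+_) c+d≡l)))) j+l≤)))

    -- The step of the induction on n. If the windows overlap, with j = i + d, the first is cut at
    -- j: its d terms before j are disjoint from the second window, and the other e = w - d terms
    -- are the beginning of it.
    equal-windows : ∀ w i j → w ℕ.≤ m → i ℕ.≤ j → j ℕ.≤ i ℕ.+ m → W i w ⊑ W j w
    equal-windows w i j w≤m i≤j j≤i+m with i ℕ.+ w ℕ.≤? j
    ... | yes i+w≤j = disjoint-windows i w j w i+w≤j j≤i+m (ℕ.+-monoˡ-≤ w j≤i+m)
    ... | no  i+w≰j = overlapping (ℕ.m≤n⇒∃[o]m+o≡n i≤j)
      where
      overlapping : (∃[ d ] i ℕ.+ d ≡ j) → W i w ⊑ W j w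
      overlapping (d , ≡.refl) = overlapping′
        (ℕ.m≤n⇒∃[o]m+o≡n (ℕ.<⇒≤ (ℕ.+-cancelˡ-< i d w (ℕ.≰⇒> i+w≰j))))
        where
        overlapping′ : (∃[ e ] d ℕ.+ e ≡ w) → W i w ⊑ W j w
        overlapping′ (e , ≡.refl) = ⊑-cong
          (≈ₚ-sym {W i (d ℕ.+ e)} {W i d +ₚ W j e} (window-++ i d e)) (λ _ → refl)
          (⊑-+ˡ
            (disjoint-windows i d j w ℕ.≤-refl j≤i+m
              (ℕ.≤-trans (ℕ.+-monoʳ-≤ (i ℕ.+ d) w≤m) (ℕ.≤-reflexive (+-swapʳ i d m))))
            (≡.subst (λ v → W j e ⊑ W j v) (ℕ.+-comm e d)
              (window⊑prolongation j e d (ℕ.≤-trans (ℕ.≤-reflexive (ℕ.+-comm e d)) w≤m))))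

-- Sections of a polynomial modulo r.

module Sections (ℝ : CompleteOrderedField) where
  open CompleteOrderedField ℝ hiding (zero)
  open Polynomials ℝ
  open IntegerSolver commutativeRing
  open OrderedField ℝ
  open RealPolynomials ℝ
  open InterlacingPairs ℝ
  open InterlacingSequences ℝ
  open SetoidReasoning setoid
  open CommutativeSemigroupProperties ℕ.+-commutativeSemigroup using (x∙yz≈y∙xz)

  ≈0⇒*ₚ≈0 : ∀ p q → p ≈ₚ 0ₚ → p *ₚ q ≈ₚ 0ₚ
  ≈0⇒*ₚ≈0 []      q p≈0 k = refl
  ≈0⇒*ₚ≈0 (a ∷ p) q p≈0 k = trans (coeff-* a p q k)
    (trans (+-cong (trans (*-congʳ (p≈0 0)) (zeroˡ _)) (tail k)) (+-identityˡ 0#))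
    where
    tail : 0# ∷ p *ₚ q ≈ₚ 0ₚ
    tail zero    = refl
    tail (suc k) = ≈0⇒*ₚ≈0 p q (λ k → p≈0 (suc k)) k

  *ₚ-congʳ : ∀ p p′ q → p ≈ₚ p′ → p *ₚ q ≈ₚ p′ *ₚ q
  *ₚ-congʳ []      p′       q p≈p′ k = sym (≈0⇒*ₚ≈0 p′ q (≈ₚ-sym {0ₚ} {p′} p≈p′) k)
  *ₚ-congʳ (a ∷ p) []       q p≈p′ k = ≈0⇒*ₚ≈0 (a ∷ p) q p≈p′ k
  *ₚ-congʳ (a ∷ p) (b ∷ p′) q p≈p′ k = trans (coeff-* a p q k)
    (trans (+-cong (*-congʳ (p≈p′ 0))
        (shift-cong {p *ₚ q} {p′ *ₚ q} (*ₚ-congʳ p p′ q (λ k → p≈p′ (suc k))) k))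
      (sym (coeff-* b p′ q k)))

  *ₚ-distribʳ : ∀ p p′ q → (p +ₚ p′) *ₚ q ≈ₚ p *ₚ q +ₚ p′ *ₚ q
  *ₚ-distribʳ []      p′       q k = refl
  *ₚ-distribʳ (a ∷ p) []       q k =
    sym (trans (coeff-+ ((a ∷ p) *ₚ q) [] k) (+-identityʳ _))
  *ₚ-distribʳ (a ∷ p) (b ∷ p′) q k = begin
    coeff ((a + b ∷ p +ₚ p′) *ₚ q) k
      ≈⟨ coeff-* (a + b) (p +ₚ p′) q k ⟩
    (a + b) * coeff q k + coeff (0# ∷ (p +ₚ p′) *ₚ q) k
      ≈⟨ +-congˡ (tail k) ⟩
    (a + b) * coeff q k + (coeff (0# ∷ p *ₚ q) k + coeff (0# ∷ p′ *ₚ q) k)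
      ≈⟨ solve 5 (λ a b q x y → (a :+ b) :* q :+ (x :+ y) := (a :* q :+ x) :+ (b :* q :+ y)) refl
           a b (coeff q k) _ _ ⟩
    (a * coeff q k + coeff (0# ∷ p *ₚ q) k) + (b * coeff q k + coeff (0# ∷ p′ *ₚ q) k)
      ≈⟨ +-cong (coeff-* a p q k) (coeff-* b p′ q k) ⟨
    coeff ((a ∷ p) *ₚ q) k + coeff ((b ∷ p′) *ₚ q) k
      ≈⟨ coeff-+ ((a ∷ p) *ₚ q) _ k ⟨
    coeff ((a ∷ p) *ₚ q +ₚ (b ∷ p′) *ₚ q) k ∎
    where
    tail : ∀ k → coeff (0# ∷ (p +ₚ p′) *ₚ q) k ≈ coeff (0# ∷ p *ₚ q) k + coeff (0# ∷ p′ *ₚ q) k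
    tail zero    = sym (+-identityˡ 0#)
    tail (suc k) = trans (*ₚ-distribʳ p p′ q k) (coeff-+ (p *ₚ q) (p′ *ₚ q) k)

  shift-*ₚ : ∀ p q → (0# ∷ p) *ₚ q ≈ₚ 0# ∷ p *ₚ q
  shift-*ₚ p q k = trans (coeff-* 0# p q k) (trans (+-congʳ (zeroˡ _)) (+-identityˡ _))

  1ₚ-*ₚ : ∀ p → 1ₚ *ₚ p ≈ₚ p
  1ₚ-*ₚ p k = trans (coeff-C 1# p k) (*-identityˡ _)

  X-*ₚ : ∀ p → X *ₚ p ≈ₚ 0# ∷ p
  X-*ₚ p k = trans (shift-*ₚ 1ₚ p k) (shift-cong {1ₚ *ₚ p} {p} (1ₚ-*ₚ p) k)

  X^suc-*ₚ : ∀ i p → X ^ₚ suc i *ₚ p ≈ₚ 0# ∷ X ^ₚ i *ₚ p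
  X^suc-*ₚ i p k = trans (*ₚ-congʳ (X *ₚ X ^ₚ i) (0# ∷ X ^ₚ i) p (X-*ₚ (X ^ₚ i)) k)
    (shift-*ₚ (X ^ₚ i) p k)

  -- Truncated subtraction sends the indices below i to the zero constant term of X p.
  coeff-X^ : ∀ i p s → coeff (0# ∷ X ^ₚ i *ₚ p) s ≈ coeff (0# ∷ p) (s ∸ i)
  coeff-X^ zero    p s       = shift-cong {1ₚ *ₚ p} {p} (1ₚ-*ₚ p) s
  coeff-X^ (suc i) p zero    = refl
  coeff-X^ (suc i) p (suc s) = trans (X^suc-*ₚ i p s) (coeff-X^ i p s)

  -- The sections of p modulo r in reverse order, continued cyclically:
  -- F k is the section of residue r - 1 - k for k < r, and F (k + r) = X F k.
  Section : ℕ → Poly → (ℕ → Poly) → Set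
  Section r p F = ∀ k t → coeff (F k) t ≈ coeff (0# ∷ p) (suc t ℕ.* r ∸ k)

  -- The index `suc t * r ∸ k` is one more than the position t r + (r - 1 - k) in p; the leading
  -- `0#` absorbs the difference. Raising k by r removes one block of length r. For t = 0 none is
  -- left, and truncation selects the constant term `0#`.
  Section⇒periodic : ∀ {r p F} → Section r p F → ∀ k → F (k ℕ.+ r) ≈ₚ 0# ∷ F k
  Section⇒periodic {r} {p} {F} section k zero = trans (section (k ℕ.+ r) 0)
    (reflexive (≡.cong (coeff (0# ∷ p)) (ℕ.m≤n⇒m∸n≡0
      (ℕ.≤-trans (ℕ.≤-reflexive (ℕ.+-identityʳ r)) (ℕ.m≤n+m r k)))))
  Section⇒periodic {r} {p} {F} section k (suc t) = trans (section (k ℕ.+ r) (suc t))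
    (trans (reflexive (≡.cong (coeff (0# ∷ p))
        (≡.trans (≡.cong (r ℕ.+ suc t ℕ.* r ∸_) (ℕ.+-comm k r)) (ℕ.[m+n]∸[m+o]≡n∸o r _ k))))
      (sym (section k t)))

  -- Multiplying p by the power o of X lowers the index by o, which is also the effect of raising k
  -- by o. Hence the product by this power has `F (k + o)` where p has `F k`.
  Section-window : ∀ {r p F} w → Section r p F →
    Section r ((∑ {w} (λ i → X ^ₚ toℕ i)) *ₚ p) (λ k → window F k w)
  Section-window {r} {p} {F} w section k t = from w 0 (λ i → X ^ₚ toℕ i) (λ i → ≡.refl) k ≡.refl
    where
    s = suc t ℕ.* r ∸ k

    -- `∑` loses its first summand at each step, so the induction carries the exponent o of the
    -- first remaining power and starts the window at o + k, while the index s stays fixed.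
    from : ∀ w o (f : Fin w → Poly) → (∀ i → f i ≡ X ^ₚ (o ℕ.+ toℕ i)) → ∀ k′ → k′ ≡ o ℕ.+ k →
      coeff (window F k′ w) t ≈ coeff (0# ∷ ∑ f *ₚ p) s
    from zero    o f f≡ k′ k′≡ = sym (zero-shift s)
      where
      zero-shift : 0# ∷ [] ≈ₚ 0ₚ
      zero-shift zero    = refl
      zero-shift (suc _) = refl
    from (suc w) o f f≡ k′ k′≡ = begin
      coeff (F k′ +ₚ window F (suc k′) w) t
        ≈⟨ coeff-+ (F k′) _ t ⟩
      coeff (F k′) t + coeff (window F (suc k′) w) t
        ≈⟨ +-cong first rest ⟩
      coeff (0# ∷ f₀ *ₚ p) s + coeff (0# ∷ ∑ f₊ *ₚ p) s
        ≈⟨ merge s ⟨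
      coeff (0# ∷ (f₀ +ₚ ∑ f₊) *ₚ p) s ∎
      where
      f₀ = f Fin.zero
      f₊ = f ∘ Fin.suc

      first : coeff (F k′) t ≈ coeff (0# ∷ f₀ *ₚ p) s
      first = begin
        coeff (F k′) t                          ≈⟨ section k′ t ⟩
        coeff (0# ∷ p) (suc t ℕ.* r ∸ k′)
          ≡⟨ ≡.cong (coeff (0# ∷ p)) (≡.trans (≡.cong (suc t ℕ.* r ∸_) (≡.trans k′≡ (ℕ.+-comm o k)))
               (≡.sym (ℕ.∸-+-assoc (suc t ℕ.* r) k o))) ⟩
        coeff (0# ∷ p) (s ∸ o)                  ≈⟨ coeff-X^ o p s ⟨
        coeff (0# ∷ X ^ₚ o *ₚ p) s
          ≡⟨ ≡.cong (λ g → coeff (0# ∷ g *ₚ p) s)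
               (≡.trans (f≡ Fin.zero) (≡.cong (X ^ₚ_) (ℕ.+-identityʳ o))) ⟨
        coeff (0# ∷ f₀ *ₚ p) s                  ∎

      rest : coeff (window F (suc k′) w) t ≈ coeff (0# ∷ ∑ f₊ *ₚ p) s
      rest = from w (suc o) f₊
        (λ i → ≡.trans (f≡ (Fin.suc i)) (≡.cong (X ^ₚ_) (ℕ.+-suc o (toℕ i))))
        (suc k′) (≡.cong suc k′≡)

      merge : ∀ s → coeff (0# ∷ (f₀ +ₚ ∑ f₊) *ₚ p) s ≈
                    coeff (0# ∷ f₀ *ₚ p) s + coeff (0# ∷ ∑ f₊ *ₚ p) s
      merge zero    = sym (+-identityˡ 0#)
      merge (suc s) = trans (*ₚ-distribʳ f₀ (∑ f₊) p s) (coeff-+ (f₀ *ₚ p) _ s)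

  -- Sections of the powers, starting from the constant 1.

  monomial : ℕ → Poly
  monomial zero    = 1ₚ
  monomial (suc q) = 0# ∷ monomial q

  coeff-monomial-≡ : ∀ q → coeff (monomial q) q ≈ 1#
  coeff-monomial-≡ zero    = refl
  coeff-monomial-≡ (suc q) = coeff-monomial-≡ q

  coeff-monomial-≢ : ∀ q t → ¬ q ≡ t → coeff (monomial q) t ≈ 0#
  coeff-monomial-≢ zero    zero    q≢t = ⊥-elim (q≢t ≡.refl)
  coeff-monomial-≢ zero    (suc t) q≢t = refl
  coeff-monomial-≢ (suc q) zero    q≢t = refl
  coeff-monomial-≢ (suc q) (suc t) q≢t = coeff-monomial-≢ q t (q≢t ∘ ≡.cong suc)

  -- Two rotations multiply both sides by x.
  monomial-refl : ∀ q → monomial q ⊑ monomial q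
  monomial-refl zero    = inj₂ (inj₂ (constants 1# 1# 0<1 0<1 (λ _ → refl) (λ _ → refl)))
  monomial-refl (suc q) = ⊑-rotate (⊑-rotate (monomial-refl q))

  -- The only nonzero coefficient of 1 is met when (t + 1) r = k + 1. So F k is the power q of x if
  -- k + 1 = (q + 1) r, and zero if r does not divide k + 1. Two nonzero terms at distance at most r
  -- have equal exponents or exponents p and p + 1, and a single rotation settles the latter case.
  sections-of-one : ∀ r → 1 ℕ.≤ r → ∃[ F ] Section r 1ₚ F × Cyclic r F
  sections-of-one r@(suc _) _ = F , section , record
    { periodic = Section⇒periodic {r} {1ₚ} {F} section
    ; pairwise = λ {i} {j} i≤j j≤i+r → pairwise i j (r ∣? suc i) (r ∣? suc j) i≤j j≤i+r
    }
    where
    term : ∀ k → Dec (r ∣ suc k) → Poly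
    term k (yes (divides zero ()))
    term k (yes (divides (suc q) _)) = monomial q
    term k (no _)                    = 0ₚ

    F : ℕ → Poly
    F k = term k (r ∣? suc k)

    coeff-1-≢ : ∀ s → ¬ s ≡ 1 → coeff (0# ∷ 1ₚ) s ≈ 0#
    coeff-1-≢ zero          s≢1 = refl
    coeff-1-≢ (suc zero)    s≢1 = ⊥-elim (s≢1 ≡.refl)
    coeff-1-≢ (suc (suc s)) s≢1 = refl

    m∸k≡1⇒m≡1+k : ∀ m k → m ∸ k ≡ 1 → m ≡ suc k
    m∸k≡1⇒m≡1+k m       zero    eq = eq
    m∸k≡1⇒m≡1+k (suc m) (suc k) eq = ≡.cong suc (m∸k≡1⇒m≡1+k m k eq)

    section : Section r 1ₚ F
    section k t = by-cases (r ∣? suc k)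
      where
      by-cases : ∀ d → coeff (term k d) t ≈ coeff (0# ∷ 1ₚ) (suc t ℕ.* r ∸ k)
      by-cases (yes (divides zero ()))
      by-cases (yes (divides (suc q) 1+k≡)) with q ℕ.≟ t
      ... | yes ≡.refl = trans (coeff-monomial-≡ q) (reflexive (≡.cong (coeff (0# ∷ 1ₚ))
        (≡.trans (≡.sym (ℕ.m+n∸n≡m 1 k)) (≡.cong (_∸ k) 1+k≡))))
      ... | no q≢t = trans (coeff-monomial-≢ q t q≢t) (sym (coeff-1-≢ _ λ eq → q≢t
        (ℕ.suc-injective (ℕ.*-cancelʳ-≡ (suc q) (suc t) r
          (≡.trans (≡.sym 1+k≡) (≡.sym (m∸k≡1⇒m≡1+k (suc t ℕ.* r) k eq)))))))
      by-cases (no r∤1+k) = sym (coeff-1-≢ _ λ eq → r∤1+k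
        (divides (suc t) (≡.sym (m∸k≡1⇒m≡1+k (suc t ℕ.* r) k eq))))

    pairwise : ∀ i j (d : Dec (r ∣ suc i)) (e : Dec (r ∣ suc j)) →
      i ℕ.≤ j → j ℕ.≤ i ℕ.+ r → term i d ⊑ term j e
    pairwise i j (yes (divides zero ())) _ _ _
    pairwise i j (no _) _ _ _ = inj₁ λ _ → refl
    pairwise i j (yes (divides (suc p) _)) (yes (divides zero ())) _ _
    pairwise i j (yes (divides (suc p) _)) (no _) _ _ = inj₂ (inj₁ λ _ → refl)
    pairwise i j (yes (divides (suc p) 1+i≡)) (yes (divides (suc q) 1+j≡)) i≤j j≤i+r
      with ℕ.m≤n⇒m<n∨m≡n q≤1+p
      where
      q≤1+p : q ℕ.≤ suc p
      q≤1+p = ℕ.≤-pred (ℕ.*-cancelʳ-≤ (suc q) (suc (suc p)) r (ℕ.≤-trans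
        (ℕ.≤-reflexive (≡.sym 1+j≡)) (ℕ.≤-trans (s≤s j≤i+r)
          (ℕ.≤-reflexive (≡.trans (≡.cong (ℕ._+ r) 1+i≡) (ℕ.+-comm (suc p ℕ.* r) r))))))
    ... | inj₂ ≡.refl = ⊑-rotate (monomial-refl p)
    ... | inj₁ (s≤s q≤p) = ≡.subst (λ q → monomial p ⊑ monomial q) (ℕ.≤-antisym p≤q q≤p)
      (monomial-refl p)
      where
      p≤q : p ℕ.≤ q
      p≤q = ℕ.≤-pred (ℕ.*-cancelʳ-≤ (suc p) (suc q) r (ℕ.≤-trans
        (ℕ.≤-reflexive (≡.sym 1+i≡)) (ℕ.≤-trans (s≤s i≤j) (ℕ.≤-reflexive 1+j≡))))

  sections-of-power : ∀ r w n → 1 ℕ.≤ r → w ℕ.≤ r →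
    ∃[ F ] Section r ((∑ {w} (λ i → X ^ₚ toℕ i)) ^ₚ n) F × Cyclic r F
  sections-of-power r w zero    1≤r w≤r = sections-of-one r 1≤r
  sections-of-power r w (suc n) 1≤r w≤r = extend (sections-of-power r w n 1≤r w≤r)
    where
    Q = ∑ {w} (λ i → X ^ₚ toℕ i)

    extend : (∃[ F ] Section r (Q ^ₚ n) F × Cyclic r F) →
             ∃[ F ] Section r (Q ^ₚ suc n) F × Cyclic r F
    extend (F , section , cyclic) = (λ k → window F k w) , section′ , record
      { periodic = Section⇒periodic {r} {Q ^ₚ suc n} {λ k → window F k w} section′
      ; pairwise = λ {i} {j} → Windows.equal-windows cyclic w i j w≤r
      }
      where
      section′ : Section r (Q ^ₚ suc n) (λ k → window F k w)
      section′ = Section-window {r} {Q ^ₚ n} {F} w section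

  -- Uniqueness of the decomposition into sections.

  coeff-X^-low : ∀ i p s → s ℕ.< i → coeff (X ^ₚ i *ₚ p) s ≈ 0#
  coeff-X^-low i p s s<i = trans (coeff-X^ i p (suc s))
    (reflexive (≡.cong (coeff (0# ∷ p)) (ℕ.m≤n⇒m∸n≡0 s<i)))

  coeff-X^-high : ∀ i p s → coeff (X ^ₚ i *ₚ p) (i ℕ.+ s) ≈ coeff p s
  coeff-X^-high i p s = trans (coeff-X^ i p (suc (i ℕ.+ s)))
    (reflexive (≡.cong (coeff (0# ∷ p))
      (≡.trans (≡.cong (_∸ i) (≡.sym (ℕ.+-suc i s))) (ℕ.m+n∸m≡n i (suc s)))))

  -- The right-hand side merges two cases: it is coefficient t of q for j = 0 and zero for the other
  -- residues j.
  coeff-⟨X^⟩ : ∀ q {r} t {j} → j ℕ.< r → coeff (q ⟨ X ^ₚ r ⟩) (t ℕ.* r ℕ.+ j) ≈ coeff (C (coeff q t)) j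
  coeff-⟨X^⟩ []      t {zero}  j<r = refl
  coeff-⟨X^⟩ []      t {suc j} j<r = refl
  coeff-⟨X^⟩ (a ∷ q) {r} zero    {j} j<r = trans (coeff-+ (C a) (X ^ₚ r *ₚ q ⟨ X ^ₚ r ⟩) j)
    (trans (+-congˡ (coeff-X^-low r (q ⟨ X ^ₚ r ⟩) j j<r)) (+-identityʳ _))
  coeff-⟨X^⟩ (a ∷ q) {r} (suc t) {j} j<r = begin
    coeff (C a +ₚ X ^ₚ r *ₚ R) (r ℕ.+ t ℕ.* r ℕ.+ j)
      ≡⟨ ≡.cong (coeff (C a +ₚ X ^ₚ r *ₚ R)) (ℕ.+-assoc r (t ℕ.* r) j) ⟩
    coeff (C a +ₚ X ^ₚ r *ₚ R) (r ℕ.+ (t ℕ.* r ℕ.+ j))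
      ≈⟨ coeff-+ (C a) (X ^ₚ r *ₚ R) _ ⟩
    coeff (C a) (r ℕ.+ (t ℕ.* r ℕ.+ j)) + coeff (X ^ₚ r *ₚ R) (r ℕ.+ (t ℕ.* r ℕ.+ j))
      ≈⟨ +-cong (constant-term r j<r) (coeff-X^-high r R _) ⟩
    0# + coeff R (t ℕ.* r ℕ.+ j)
      ≈⟨ +-identityˡ _ ⟩
    coeff R (t ℕ.* r ℕ.+ j)
      ≈⟨ coeff-⟨X^⟩ q t j<r ⟩
    coeff (C (coeff q t)) j ∎
    where
    R = q ⟨ X ^ₚ r ⟩

    constant-term : ∀ r {s} → j ℕ.< r → coeff (C a) (r ℕ.+ s) ≈ 0#
    constant-term (suc r) _ = refl

  coeff-X^-⟨X^⟩-≡ : ∀ q {r} t {i} → i ℕ.< r → coeff (X ^ₚ i *ₚ q ⟨ X ^ₚ r ⟩) (t ℕ.* r ℕ.+ i) ≈ coeff q t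
  coeff-X^-⟨X^⟩-≡ q {r} t {i} i<r = begin
    coeff (X ^ₚ i *ₚ R) (t ℕ.* r ℕ.+ i)    ≡⟨ ≡.cong (coeff (X ^ₚ i *ₚ R)) (ℕ.+-comm (t ℕ.* r) i) ⟩
    coeff (X ^ₚ i *ₚ R) (i ℕ.+ t ℕ.* r)    ≈⟨ coeff-X^-high i R (t ℕ.* r) ⟩
    coeff R (t ℕ.* r)                      ≡⟨ ≡.cong (coeff R) (ℕ.+-identityʳ (t ℕ.* r)) ⟨
    coeff R (t ℕ.* r ℕ.+ 0)                ≈⟨ coeff-⟨X^⟩ q t (ℕ.≤-trans (s≤s z≤n) i<r) ⟩
    coeff q t                              ∎
    where
    R = q ⟨ X ^ₚ r ⟩

  -- After removing the power i of X, the position has residue j - i if i < j, or r - (i - j) in the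
  -- preceding block if i > j. Either residue is nonzero and below r. If there is no preceding
  -- block, the position lies below i.
  coeff-X^-⟨X^⟩-≢ : ∀ q {r} t {i j} → i ℕ.< r → j ℕ.< r → ¬ i ≡ j →
    coeff (X ^ₚ i *ₚ q ⟨ X ^ₚ r ⟩) (t ℕ.* r ℕ.+ j) ≈ 0#
  coeff-X^-⟨X^⟩-≢ q {r} t {i} {j} i<r j<r i≢j = by-cases (ℕ.<-cmp i j) t
    where
    R = q ⟨ X ^ₚ r ⟩

    offset : ∀ t s d → t ℕ.* r ℕ.+ j ≡ i ℕ.+ (s ℕ.* r ℕ.+ suc d) → suc d ℕ.< r →
      coeff (X ^ₚ i *ₚ R) (t ℕ.* r ℕ.+ j) ≈ 0#
    offset t s d eq d<r = trans (reflexive (≡.cong (coeff (X ^ₚ i *ₚ R)) eq))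
      (trans (coeff-X^-high i R _) (coeff-⟨X^⟩ q s d<r))

    by-cases : Tri (i ℕ.< j) (i ≡ j) (j ℕ.< i) → ∀ t → coeff (X ^ₚ i *ₚ R) (t ℕ.* r ℕ.+ j) ≈ 0#
    by-cases (tri≈ _ i≡j _) t = ⊥-elim (i≢j i≡j)
    by-cases (tri< i<j _ _) t = above (ℕ.m≤n⇒∃[o]m+o≡n i<j)
      where
      above : (∃[ d ] suc i ℕ.+ d ≡ j) → coeff (X ^ₚ i *ₚ R) (t ℕ.* r ℕ.+ j) ≈ 0#
      above (d , eq) = offset t t d
        (≡.trans (≡.cong (t ℕ.* r ℕ.+_) j≡) (x∙yz≈y∙xz (t ℕ.* r) i (suc d)))
        (ℕ.≤-<-trans (ℕ.≤-trans (ℕ.m≤n+m (suc d) i) (ℕ.≤-reflexive (≡.sym j≡))) j<r)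
        where
        j≡ : j ≡ i ℕ.+ suc d
        j≡ = ≡.trans (≡.sym eq) (≡.sym (ℕ.+-suc i d))
    by-cases (tri> _ _ j<i) zero    = coeff-X^-low i R j j<i
    by-cases (tri> _ _ j<i) (suc t) = below (ℕ.m≤n⇒∃[o]m+o≡n i<r)
      where
      open +-*-Solver using () renaming (solve to ℕ-solve; _:+_ to _⊕_; _:=_ to _⊜_; con to num)

      below : (∃[ g ] suc i ℕ.+ g ≡ r) → coeff (X ^ₚ i *ₚ R) (suc t ℕ.* r ℕ.+ j) ≈ 0#
      below (g , eq) = offset (suc t) t (g ℕ.+ j)
        (≡.trans (≡.cong (λ r′ → r′ ℕ.+ t ℕ.* r ℕ.+ j) (≡.sym eq))
          (ℕ-solve 4 (λ i g m j → num 1 ⊕ i ⊕ g ⊕ m ⊕ j ⊜ i ⊕ (m ⊕ (num 1 ⊕ (g ⊕ j))))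
            ≡.refl i g (t ℕ.* r) j))
        (≡.subst (suc (g ℕ.+ j) ℕ.<_) (≡.trans (≡.cong suc (ℕ.+-comm g i)) eq)
          (s≤s (≡.subst (ℕ._≤ g ℕ.+ i) (ℕ.+-suc g j) (ℕ.+-monoʳ-≤ g j<i))))

  coeff-∑-single : ∀ {w} (f : Vector Poly w) i s → (∀ j → ¬ j ≡ i → coeff (f j) s ≈ 0#) →
    coeff (∑ f) s ≈ coeff (f i) s
  coeff-∑-single {suc w} f Fin.zero    s others = trans (coeff-+ (f Fin.zero) (∑ (f ∘ Fin.suc)) s)
    (trans (+-congˡ (all-zero (f ∘ Fin.suc) (λ j → others (Fin.suc j) λ ()))) (+-identityʳ _))
    where
    all-zero : ∀ {w} (f : Vector Poly w) → (∀ j → coeff (f j) s ≈ 0#) → coeff (∑ f) s ≈ 0#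
    all-zero {zero}  f zeros = refl
    all-zero {suc w} f zeros = trans (coeff-+ (f Fin.zero) (∑ (f ∘ Fin.suc)) s)
      (trans (+-cong (zeros Fin.zero) (all-zero (f ∘ Fin.suc) (zeros ∘ Fin.suc))) (+-identityˡ 0#))
  coeff-∑-single {suc w} f (Fin.suc i) s others = trans (coeff-+ (f Fin.zero) (∑ (f ∘ Fin.suc)) s)
    (trans (+-cong (others Fin.zero λ ())
        (coeff-∑-single (f ∘ Fin.suc) i s (λ j j≢i → others (Fin.suc j) (j≢i ∘ Fin.suc-injective))))
      (+-identityˡ _))

  -- The positions t r + i′ in p see only the summand with index i′, since all other summands live
  -- in other residue classes.
  section-unique : ∀ {r p F} (h : Fin r → Poly) → p ≈ₚ ∑ (λ i → X ^ₚ toℕ i *ₚ h i ⟨ X ^ₚ r ⟩) →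
    Section r p F → ∀ i → F (toℕ i) ≈ₚ h (opposite i)
  section-unique {r} {p} {F} h p≈ section i t = begin
    coeff (F (toℕ i)) t                             ≈⟨ section (toℕ i) t ⟩
    coeff (0# ∷ p) (suc t ℕ.* r ∸ toℕ i)            ≡⟨ ≡.cong (coeff (0# ∷ p)) index ⟩
    coeff p (t ℕ.* r ℕ.+ toℕ i′)                    ≈⟨ p≈ _ ⟩
    coeff (∑ summand) (t ℕ.* r ℕ.+ toℕ i′)          ≈⟨ coeff-∑-single summand i′ _ others ⟩
    coeff (summand i′) (t ℕ.* r ℕ.+ toℕ i′)         ≈⟨ coeff-X^-⟨X^⟩-≡ (h i′) t (Fin.toℕ<n i′) ⟩
    coeff (h i′) t                                  ∎
    where
    i′ = opposite i

    summand : Fin r → Poly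
    summand j = X ^ₚ toℕ j *ₚ h j ⟨ X ^ₚ r ⟩

    others : ∀ j → ¬ j ≡ i′ → coeff (summand j) (t ℕ.* r ℕ.+ toℕ i′) ≈ 0#
    others j j≢i′ = coeff-X^-⟨X^⟩-≢ (h j) t (Fin.toℕ<n j) (Fin.toℕ<n i′) (j≢i′ ∘ Fin.toℕ-injective)

    -- `opposite i` is r - 1 - i; the additional 1 is the shift by the leading `0#`.
    index : suc t ℕ.* r ∸ toℕ i ≡ suc (t ℕ.* r ℕ.+ toℕ i′)
    index = ≡.trans (≡.cong (_∸ toℕ i) (ℕ.+-comm r (t ℕ.* r)))
      (≡.trans (ℕ.+-∸-assoc (t ℕ.* r) (ℕ.<⇒≤ (Fin.toℕ<n i)))
        (≡.trans (≡.cong (t ℕ.* r ℕ.+_) (≡.trans (ℕ.+-∸-assoc 1 (Fin.toℕ<n i))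
            (≡.cong suc (≡.sym (Fin.opposite-prop i)))))
          (ℕ.+-suc (t ℕ.* r) (toℕ i′))))

  -- From merged zero lists to the vectors of zeros in `_≪_`.

  record Roots (b : Carrier) (f : Poly) {d : ℕ} (u : Vector Carrier d) : Set where
    field
      bounded       : ∀ i → u i ≤ b
      decreasing    : ∀ {i j} → i Fin.≤ j → u j ≤ u i
      scale         : Carrier
      0<scale       : 0# < scale
      factorisation : f ≈ₚ C scale *ₚ ∏ (λ i → X +ₚ C (- u i))

  Roots-constant : ∀ {b f} c (u : Vector Carrier 0) → 0# < c → f ≈ₚ C c → Roots b f u
  Roots-constant c u 0<c f≈ = record
    { bounded       = λ ()
    ; decreasing    = λ { {()} }
    ; scale         = c
    ; 0<scale       = 0<c
    ; factorisation = λ k → trans (f≈ k) (sym (C-*1 k))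
    }
    where
    C-*1 : C c *ₚ 1ₚ ≈ₚ C c
    C-*1 zero    = trans (coeff-C c 1ₚ 0) (*-identityʳ c)
    C-*1 (suc k) = trans (coeff-C c 1ₚ (suc k)) (zeroʳ c)

  C-[X-]-comm : ∀ c a p → C c *ₚ [X- a ] p ≈ₚ [X- a ] (C c *ₚ p)
  C-[X-]-comm c a p zero    = begin
    coeff (C c *ₚ [X- a ] p) 0
      ≈⟨ trans (coeff-C c ([X- a ] p) 0) (*-congˡ (coeff-[X-]-zero a p)) ⟩
    c * - (a * coeff p 0)
      ≈⟨ solve 3 (λ c a x → c :* :- (a :* x) := :- (a :* (c :* x))) refl c a (coeff p 0) ⟩
    - (a * (c * coeff p 0))
      ≈⟨ trans (coeff-[X-]-zero a (C c *ₚ p)) (-‿cong (*-congˡ (coeff-C c p 0))) ⟨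
    coeff ([X- a ] (C c *ₚ p)) 0 ∎
  C-[X-]-comm c a p (suc k) = begin
    coeff (C c *ₚ [X- a ] p) (suc k)
      ≈⟨ trans (coeff-C c ([X- a ] p) (suc k)) (*-congˡ (coeff-[X-]-suc a p k)) ⟩
    c * (coeff p k - a * coeff p (suc k))
      ≈⟨ solve 4 (λ c a x y → c :* (x :- a :* y) := c :* x :- a :* (c :* y)) refl
           c a (coeff p k) (coeff p (suc k)) ⟩
    c * coeff p k - a * (c * coeff p (suc k))
      ≈⟨ trans (coeff-[X-]-suc a (C c *ₚ p) k)
           (+-cong (coeff-C c p k) (-‿cong (*-congˡ (coeff-C c p (suc k))))) ⟨
    coeff ([X- a ] (C c *ₚ p)) (suc k) ∎

  -- The bound in `Roots` makes the new head a the largest entry, and the positive scale is kept for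
  -- the sign of the leading coefficient; `ZeroList` records neither.
  Roots-∷ : ∀ {a b f d} f′ {u : Vector Carrier d} → a ≤ b → f ≈ₚ [X- a ] f′ → Roots a f′ u →
    Roots b f (a Vector.∷ u)
  Roots-∷ {a} {b} {f} f′ {u} a≤b f≈ roots = record
    { bounded       = λ { Fin.zero → a≤b ; (Fin.suc i) → ≤-trans (bounded i) a≤b }
    ; decreasing    = decreasing′
    ; scale         = scale
    ; 0<scale       = 0<scale
    ; factorisation = λ k → trans (f≈ k) (trans
        ([X-]-cong a {f′} {C scale *ₚ P} factorisation k) (sym (C-[X-]-comm scale a P k)))
    }
    where
    open Roots roots
    P = ∏ (λ i → X +ₚ C (- u i))

    decreasing′ : ∀ {i j} → i Fin.≤ j → (a Vector.∷ u) j ≤ (a Vector.∷ u) i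
    decreasing′ {Fin.zero}  {Fin.zero}  _         = ≤-refl
    decreasing′ {Fin.zero}  {Fin.suc j} _         = bounded j
    decreasing′ {Fin.suc i} {Fin.suc j} (s≤s i≤j) = decreasing i≤j

  Roots-weaken : ∀ {b c f d} {u : Vector Carrier d} → b ≤ c → Roots b f u → Roots c f u
  Roots-weaken b≤c roots = record
    { bounded = λ i → ≤-trans (bounded i) b≤c ; decreasing = decreasing ; scale = scale
    ; 0<scale = 0<scale ; factorisation = factorisation }
    where open Roots roots

  Roots⇒ZeroList : ∀ {b f d} {u : Vector Carrier d} → Roots b f u → ZeroList f u
  Roots⇒ZeroList roots = record
    { decreasing    = decreasing
    ; constant      = scale
    ; constant≉0    = λ c≈0 → <-irrefl (sym c≈0) 0<scale
    ; factorisation = factorisation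
    }
    where open Roots roots

  ∏-monic : ∀ {d} (u : Vector Carrier d) → let P = ∏ (λ i → X +ₚ C (- u i)) in
    coeff P d ≈ 1# × (∀ k → d ℕ.< k → coeff P k ≈ 0#)
  ∏-monic {zero}  u = refl , λ { (suc k) _ → refl }
  ∏-monic {suc d} u = from (∏-monic (u ∘ Fin.suc))
    where
    a = u Fin.zero
    P = ∏ (λ i → X +ₚ C (- u (Fin.suc i)))

    from : coeff P d ≈ 1# × (∀ k → d ℕ.< k → coeff P k ≈ 0#) →
      coeff ([X- a ] P) (suc d) ≈ 1# × (∀ k → suc d ℕ.< k → coeff ([X- a ] P) k ≈ 0#)
    from (lead , vanish) = trans (lower d ℕ.≤-refl) lead ,
      λ { (suc k) (s≤s d<k) → trans (lower k (ℕ.<⇒≤ d<k)) (vanish k d<k) }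
      where
      lower : ∀ k → d ℕ.≤ k → coeff ([X- a ] P) (suc k) ≈ coeff P k
      lower k d≤k = begin
        coeff ([X- a ] P) (suc k)          ≈⟨ coeff-[X-]-suc a P k ⟩
        coeff P k - a * coeff P (suc k)    ≈⟨ +-congˡ (-‿cong (*-congˡ (vanish (suc k) (s≤s d≤k)))) ⟩
        coeff P k - a * 0#                 ≈⟨ solve 2 (λ c a → c :- a :* con (+ 0) := c) refl _ a ⟩
        coeff P k                          ∎

  Roots⇒PositiveLeading : ∀ {b f d} {u : Vector Carrier d} → Roots b f u → PositiveLeading f
  Roots⇒PositiveLeading {d = d} {u} roots = d ,
    <-respʳ (sym (trans (factorisation d) (trans (coeff-C scale P d)
      (trans (*-congˡ (proj₁ (∏-monic u))) (*-identityʳ scale))))) 0<scale ,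
    λ k d<k → trans (factorisation k) (trans (coeff-C scale P k)
      (trans (*-congˡ (proj₂ (∏-monic u) k d<k)) (zeroʳ scale)))
    where
    open Roots roots
    P = ∏ (λ i → X +ₚ C (- u i))

  data InterlacingRoots (b : Carrier) (g f : Poly) : Set where
    same : ∀ {d} {u v : Vector Carrier d} → Roots b f u → Roots b g v →
      (∀ i → v i ≤ u i) → (∀ i j → toℕ j ≡ suc (toℕ i) → u j ≤ v i) → InterlacingRoots b g f
    next : ∀ {d} {u : Vector Carrier (suc d)} {v : Vector Carrier d} → Roots b f u → Roots b g v →
      (∀ i → v i ≤ u (Fin.inject₁ i)) → (∀ i → u (Fin.suc i) ≤ v i) → InterlacingRoots b g f

  -- Each `cons` exchanges the roles of the polynomials and adds one zero, so `same` and `next` take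
  -- turns: equal degrees become degrees differing by one, and conversely.
  Inter⇒InterlacingRoots : ∀ {b g f} → Inter b g f → InterlacingRoots b g f
  Inter⇒InterlacingRoots (constants c d 0<c 0<d g≈ f≈) =
    same (Roots-constant d (λ ()) 0<d f≈) (Roots-constant c (λ ()) 0<c g≈) (λ ()) (λ ())
  Inter⇒InterlacingRoots {b} {g} {f} (cons a f′ a≤b f≈ I) = extend (Inter⇒InterlacingRoots I)
    where
    extend : InterlacingRoots a f′ g → InterlacingRoots b g f
    extend (same {d} {u} {v} roots-g roots-f′ v≤u u≤v) =
      next (Roots-∷ f′ a≤b f≈ roots-f′) (Roots-weaken a≤b roots-g) upper v≤u
      where
      upper : ∀ i → u i ≤ (a Vector.∷ v) (Fin.inject₁ i)
      upper Fin.zero    = Roots.bounded roots-g Fin.zero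
      upper (Fin.suc i) = u≤v (Fin.inject₁ i) (Fin.suc i) (≡.cong suc (≡.sym (Fin.toℕ-inject₁ i)))
    extend (next {d} {u} {v} roots-g roots-f′ v≤u u≤v) =
      same (Roots-∷ f′ a≤b f≈ roots-f′) (Roots-weaken a≤b roots-g) upper lower
      where
      upper : ∀ i → u i ≤ (a Vector.∷ v) i
      upper Fin.zero    = Roots.bounded roots-g Fin.zero
      upper (Fin.suc i) = u≤v i

      lower : ∀ i j → toℕ j ≡ suc (toℕ i) → (a Vector.∷ v) j ≤ u i
      lower i (Fin.suc j) eq = ≡.subst (λ i → v j ≤ u i)
        (Fin.toℕ-injective (≡.trans (Fin.toℕ-inject₁ j) (ℕ.suc-injective eq))) (v≤u j)

  InterlacingRoots⇒≪ : ∀ {b g f} → InterlacingRoots b g f → g ≪ f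
  InterlacingRoots⇒≪ (same roots-f roots-g v≤u u≤v) =
    sameDegree (Roots⇒PositiveLeading roots-f) (Roots⇒ZeroList roots-f)
      (Roots⇒PositiveLeading roots-g) (Roots⇒ZeroList roots-g) v≤u u≤v
  InterlacingRoots⇒≪ (next roots-f roots-g v≤u u≤v) =
    nextDegree (Roots⇒PositiveLeading roots-f) (Roots⇒ZeroList roots-f)
      (Roots⇒PositiveLeading roots-g) (Roots⇒ZeroList roots-g) v≤u u≤v

  Inter⇒Roots : ∀ {b f} → Inter b f f → ∃[ d ] ∃[ u ] Roots b f {d} u
  Inter⇒Roots I = from (Inter⇒InterlacingRoots I)
    where
    from : ∀ {b f g} → InterlacingRoots b g f → ∃[ d ] ∃[ u ] Roots b f {d} u
    from (same roots _ _ _) = _ , _ , roots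
    from (next roots _ _ _) = _ , _ , roots

  ⊑-refl⇒RealRooted : ∀ {f} → f ⊑ f → RealRooted f
  ⊑-refl⇒RealRooted (inj₁ f≈0)        = inj₁ f≈0
  ⊑-refl⇒RealRooted (inj₂ (inj₁ f≈0)) = inj₁ f≈0
  ⊑-refl⇒RealRooted (inj₂ (inj₂ I))   =
    inj₂ (_ , _ , Roots⇒ZeroList (proj₂ (proj₂ (Inter⇒Roots I))))

  ⊑-refl⇒leading : ∀ {f} → f ⊑ f → f ≈ₚ 0ₚ ⊎ PositiveLeading f
  ⊑-refl⇒leading (inj₁ f≈0)        = inj₁ f≈0
  ⊑-refl⇒leading (inj₂ (inj₁ f≈0)) = inj₁ f≈0
  ⊑-refl⇒leading (inj₂ (inj₂ I))   =
    inj₂ (Roots⇒PositiveLeading (proj₂ (proj₂ (Inter⇒Roots I))))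

  -- In the degenerate cases the comparison of the other polynomial with itself supplies the
  -- real-rootedness that `_≪_` demands.
  ⊑⇒≪ : ∀ {f g} → f ⊑ f → g ⊑ g → f ⊑ g → f ≪ g
  ⊑⇒≪ f⊑f g⊑g (inj₁ f≈0)        = zero-≪ f≈0 (⊑-refl⇒RealRooted g⊑g)
  ⊑⇒≪ f⊑f g⊑g (inj₂ (inj₁ g≈0)) = ≪-zero g≈0 (⊑-refl⇒RealRooted f⊑f)
  ⊑⇒≪ f⊑f g⊑g (inj₂ (inj₂ I))   = InterlacingRoots⇒≪ (Inter⇒InterlacingRoots I)

  pairwise⊑⇒Interlacing : ∀ {m} (f : Vector Poly m) → (∀ {i j} → i Fin.≤ j → f i ⊑ f j) →
    Interlacing f
  pairwise⊑⇒Interlacing f f⊑f = record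
    { realRooted  = λ i → ⊑-refl⇒RealRooted (f⊑f (Fin.≤-refl {x = i}))
    ; leading     = λ i → ⊑-refl⇒leading (f⊑f (Fin.≤-refl {x = i}))
    ; interlacing = λ {i} {j} i<j →
        ⊑⇒≪ (f⊑f (Fin.≤-refl {x = i})) (f⊑f (Fin.≤-refl {x = j})) (f⊑f (ℕ.<⇒≤ i<j))
    }

  interlacing-sections : (r ℓ n : ℕ) → 1 ℕ.≤ r → ℓ ℕ.≤ r ∸ 1 → (h : Fin r → Poly) →
    (∑ {suc ℓ} (λ i → X ^ₚ toℕ i)) ^ₚ n ≈ₚ ∑ (λ i → X ^ₚ toℕ i *ₚ h i ⟨ X ^ₚ r ⟩) →
    Interlacing (λ i → h (opposite i))
  interlacing-sections r@(suc r-1) ℓ n 1≤r ℓ≤r-1 h h-sections =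
    from (sections-of-power r (suc ℓ) n 1≤r (s≤s ℓ≤r-1))
    where
    p = (∑ {suc ℓ} (λ i → X ^ₚ toℕ i)) ^ₚ n

    from : (∃[ F ] Section r p F × Cyclic r F) → Interlacing (λ i → h (opposite i))
    from (F , section , cyclic) = pairwise⊑⇒Interlacing (λ i → h (opposite i)) λ {i} {j} i≤j →
      ⊑-cong (section-unique {p = p} {F} h h-sections section i)
             (section-unique {p = p} {F} h h-sections section j)
        -- All indices are below r, so any two of them are within one period.
        (Cyclic.pairwise cyclic i≤j (ℕ.≤-trans (ℕ.<⇒≤ (Fin.toℕ<n j)) (ℕ.m≤n+m r (toℕ i))))

open import Data.Nat using (_≤_)

corollary4 : (ℝ : CompleteOrderedField) → let open Polynomials ℝ in
    (r ℓ n : ℕ) → 1 ≤ r → 1 ≤ ℓ → ℓ ≤ r ∸ 1 → 1 ≤ n →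
    (h : Fin r → Poly) →
    (∑ {suc ℓ} (λ i → X ^ₚ toℕ i)) ^ₚ n
    ≈ₚ ∑ (λ i → X ^ₚ toℕ i *ₚ h i ⟨ X ^ₚ r ⟩) →
    Interlacing (λ i → h (opposite i))
corollary4 ℝ r ℓ n 1≤r _ ℓ≤r-1 _ = Sections.interlacing-sections ℝ r ℓ n 1≤r ℓ≤r-1
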